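{- Let $K$ be an abstract elementary class, let $\lambda\ge\mathrm{LS}(K)$, and let $\mathfrak{s}_1,\mathfrak{s}_2$ be weakly successful good $\lambda$-frames with underlying AEC $K$ and the same basic types. Then $\mathfrak{s}_1=\mathfrak{s}_2$ (that is, their nonforking relations coincide).
   Context: No monster model is assumed. $K_\lambda$ is the class of models of $K$ of size $\lambda$. For $M\prec N$ in $K_\lambda$ and $a\in N$, $\mathrm{gtp}(a/M;N)$ is the Galois type: $\mathrm{gtp}(a_1/M;N_1)=\mathrm{gtp}(a_2/M;N_2)$ iff there are $N\in K_\lambda$ and $K$-embeddings $f_\ell:N_\ell\to N$ fixing $M$ pointwise with $f_1(a_1)=f_2(a_2)$ (an equivalence relation under amalgamation in $K_\lambda$). $S(M)$ is the set of Galois types of single elements over $M$; a type is nonalgebraic if it is not realized in $M$. A superlimit model in $K_\lambda$ is $M\in K_\lambda$ such that every model of $K_\lambda$ embeds into $M$; for every $N\in K_\lambda$ with $M\prec N$ there is $M'\in K_\lambda$ with $N\prec M'$, $N\neq M'$, and $M'\cong M$; and the union of any increasing chain of length a limit ordinal $\delta<\lambda^+$ of models isomorphic to $M$ is isomorphic to $M$. A good $\lambda$-frame (Shelah) is $\mathfrak{s}=(K,S^{\mathrm{bs}},\downarrow)$ such that: (A) $K$ is an AEC with $\mathrm{LS}(K)\le\lambda$ and $K_\lambda\ne\emptyset$. (B) $K_\lambda$ has a superlimit model. (C) $K_\lambda$ has amalgamation, joint embedding and no $\prec$-maximal model. (D) For $M\in K_\lambda$, $S^{\mathrm{bs}}(M)\subseteq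 S(M)$ is a set of nonalgebraic types (the basic types), invariant under isomorphism. Density: if $M\prec N$ are in $K_\lambda$ and $M\ne N$, there is $a\in N\setminus M$ with $\mathrm{gtp}(a/M;N)\in S^{\mathrm{bs}}(M)$. Stability: $|S^{\mathrm{bs}}(M)|\le\lambda$ for all $M\in K_\lambda$. (E) $\downarrow$ is a relation, invariant under isomorphism, on quadruples $(M_0,a,M_1,M_3)$ with $M_0\prec M_1\prec M_3$ in $K_\lambda$, $a\in M_3\setminus M_1$, written $a\downarrow_{M_0}^{M_3}M_1$; whenever it holds, $\mathrm{gtp}(a/M_0;M_3)$ and $\mathrm{gtp}(a/M_1;M_3)$ are basic. All models below are in $K_\lambda$. - Monotonicity: if $a\downarrow_{M_0}^{M_3}M_1$, $M_0\prec M_0'\prec M_1'\prec M_1\prec M_3\prec M_3'$, then $a\downarrow_{M_0'}^{M_3'}M_1'$; and moreover if $M_1'\cup\{a\}\subseteq M_3''\prec M_3'$ then $a\downarrow_{M_0'}^{M_3''}M_1'$. Hence it makes sense to say that $p\in S^{\mathrm{bs}}(M_1)$ does not fork over $M_0$, meaning $a\downarrow_{M_0}^{M_3}M_1$ for some (equivalently any) $(a,M_3)$ with $p=\mathrm{gtp}(a/M_1;M_3)$. - Local character: if $\delta<\lambda^+$ is a limit ordinal, $(M_i)_{i\le\delta}$ is increasing continuous and $p\in S^{\mathrm{bs}}(M_\delta)$, then $p$ does not fork over $M_i$ for some $i<\delta$. - Transitivity: if $M_0\prec M_1\prec M_2$, $p\in S^{\mathrm{bs}}(M_2)$ does not fork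 over $M_1$ and $p\upharpoonright M_1$ does not fork over $M_0$, then $p$ does not fork over $M_0$. - Uniqueness: if $M_0\prec M_1$ and $p,q\in S^{\mathrm{bs}}(M_1)$ do not fork over $M_0$ and $p\upharpoonright M_0=q\upharpoonright M_0$, then $p=q$. - Symmetry: if $M_0\prec M_1\prec M_3$, $a_1\in M_1$, $\mathrm{gtp}(a_1/M_0;M_3)\in S^{\mathrm{bs}}(M_0)$ and $a_2\downarrow_{M_0}^{M_3}M_1$, then there are $M_2,M_3'$ with $M_0\prec M_2\prec M_3'$, $M_3\prec M_3'$, $a_2\in M_2$ and $a_1\downarrow_{M_0}^{M_3'}M_2$. - Extension: if $M\prec N$ and $p\in S^{\mathrm{bs}}(M)$, there is $q\in S^{\mathrm{bs}}(N)$ extending $p$ which does not fork over $M$. - Continuity: if $\delta<\lambda^+$ is a limit ordinal, $(M_i)_{i\le\delta}$ is increasing continuous, $p\in S(M_\delta)$, and for all $i<\delta$ $p\upharpoonright M_i\in S^{\mathrm{bs}}(M_i)$ does not fork over $M_0$, then $p\in S^{\mathrm{bs}}(M_\delta)$ and $p$ does not fork over $M_0$. Weakly successful. A triple $(a,M,N)$ with $M\prec N$ in $K_\lambda$, $a\in N$ and $\mathrm{gtp}(a/M;N)\in S^{\mathrm{bs}}(M)$ is a uniqueness triple of $\mathfrak{s}$ if for every $M_1\in K_\lambda$ with $M\prec M_1$ and any two amalgams $(f_\ell,g_\ell,N_\ell)$ ($\ell=1,2$), where $N_\ell\in K_\lambda$ and $f_\ell:M_1\to N_\ell$, $g_\ell:N\to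 N_\ell$ are $K$-embeddings fixing $M$ pointwise with $\mathrm{gtp}(g_\ell(a)/f_\ell[M_1];N_\ell)$ not forking over $M$, there are $N_*\in K_\lambda$ and $K$-embeddings $h_\ell:N_\ell\to N_*$ with $h_1\circ f_1=h_2\circ f_2$ and $h_1\circ g_1=h_2\circ g_2$. The frame $\mathfrak{s}$ is weakly successful if for every $M\in K_\lambda$ and $p\in S^{\mathrm{bs}}(M)$ there are $N,a$ such that $p=\mathrm{gtp}(a/M;N)$ and $(a,M,N)$ is a uniqueness triple of $\mathfrak{s}$. "The same basic types" means $S^{\mathrm{bs}}_{\mathfrak{s}_1}(M)=S^{\mathrm{bs}}_{\mathfrak{s}_2}(M)$ for all $M\in K_\lambda$. -}

-- Good frames in abstract elementary classes.
--
-- Type theory has no membership relation between structures, so M ≺ N is rendered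
-- throughout by a K-embedding M → N (an isomorphism of M onto some M′ ≺ N), and a
-- configuration such as M₀ ≺ M₁ ≺ M₃ by composable K-embeddings.  Maps "fixing M
-- pointwise" become maps making the evident triangle over M commute.  Cardinals are
-- represented by types, compared by injections and identified by bijections.

module Defs where

open import Axiom.ExcludedMiddle using (ExcludedMiddle)
open import Axiom.Extensionality.Propositional using (Extensionality)
open import Data.Nat.Base using (ℕ)
open import Data.Product.Base using (Σ; Σ-syntax; ∃; ∃-syntax; _×_; _,_; proj₁; proj₂)
open import Data.Sum.Base using (_⊎_; inj₁; inj₂)
open import Data.Vec.Base using (Vec; map)
open import Data.Vec.Properties using (map-id)
open import Function.Base using (id; _∘_)
open import Function.Bundles using (_↣_; _↔_; _⇔_; Injection; Inverse)
open import Function.Construct.Identity using (↔-id; ⇔-id)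
open import Function.Definitions using (Injective)
open import Induction.WellFounded using (WellFounded)
open import Level using (Level; suc; Setω)
open import Relation.Binary.Core using (Rel)
open import Relation.Binary.PropositionalEquality using (_≡_; _≗_; refl; cong; sym; subst)
open import Relation.Binary.Structures using (IsStrictTotalOrder)
import Relation.Binary.Construct.StrictToNonStrict as NonStrict
open import Relation.Nullary.Negation.Core using (¬_)

-- Excluded middle is the library's version, which decides arbitrary types and not only
-- propositions.  As it turns a non-empty type into an inhabited one, it also provides choice.
record Classical : Setω where
  field
    excludedMiddle : ∀ {a} → ExcludedMiddle a
    extensionality : ∀ {a b} → Extensionality a b

record Signature (ℓ : Level) : Set (suc ℓ) where
  field
    FunSym   : Set ℓ
    RelSym   : Set ℓ
    funArity : FunSym → ℕ
    relArity : RelSym → ℕ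

record Structure {ℓ} (τ : Signature ℓ) : Set (suc ℓ) where
  open Signature τ
  field
    Carrier : Set ℓ
    fun     : (f : FunSym) → Vec Carrier (funArity f) → Carrier
    rel     : (r : RelSym) → Vec Carrier (relArity r) → Set ℓ

open Structure using (Carrier)

record IsEmbedding {ℓ} {τ : Signature ℓ} (M N : Structure τ)
                   (h : Carrier M → Carrier N) : Set ℓ where
  private
    module M = Structure M
    module N = Structure N
  field
    injective : Injective _≡_ _≡_ h
    fun-homo  : ∀ f xs → h (M.fun f xs) ≡ N.fun f (map h xs)
    rel-iff   : ∀ r xs → M.rel r xs ⇔ N.rel r (map h xs)

record _≅_ {ℓ} {τ : Signature ℓ} (M N : Structure τ) : Set ℓ where
  field
    bijection : Carrier M ↔ Carrier N
  to : Carrier M → Carrier N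
  to = Inverse.to bijection
  field
    isEmbedding : IsEmbedding M N to

open _≅_ using (to)

IsOnto : ∀ {a b} {A : Set a} {B : Set b} → (A → B) → Set _
IsOnto f = ∀ y → ∃[ x ] f x ≡ y

-- A limit ordinal, presented as a well-order.
record LimitOrdinal (ℓ : Level) : Set (suc ℓ) where
  field
    Index              : Set ℓ
    _<_                : Rel Index ℓ
    isStrictTotalOrder : IsStrictTotalOrder _≡_ _<_
    wellFounded        : WellFounded _<_
  open NonStrict _≡_ _<_ public using (_≤_)
  field
    bottom             : Index
    bottom-least       : ∀ i → bottom ≤ i
    no-last            : ∀ i → ∃[ j ] i < j

  IsLimitPoint : Index → Set ℓ
  IsLimitPoint j = (∃[ i ] i < j) × (∀ i → i < j → ∃[ k ] i < k × k < j)

-- Strong M N f says that f is a K-embedding, i.e. f is an isomorphism of M onto some M′ ≺ N.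
record AbstractClass (ℓ : Level) : Set (suc (suc ℓ)) where
  field
    τ      : Signature ℓ
    Member : Structure τ → Set (suc ℓ)
    Strong : (M N : Structure τ) → (Carrier M → Carrier N) → Set (suc ℓ)

module _ {ℓ} (K : AbstractClass ℓ) where
  open AbstractClass K
  open Signature τ using (FunSym; RelSym)

  -- Increasing, but not necessarily continuous or strictly increasing.
  record Chain (δ : LimitOrdinal ℓ) : Set (suc ℓ) where
    open LimitOrdinal δ
    field
      obj        : Index → Structure τ
      hom        : ∀ {i j} → i ≤ j → Carrier (obj i) → Carrier (obj j)
      hom-strong : ∀ {i j} (p : i ≤ j) → Strong (obj i) (obj j) (hom p)
      hom-id     : ∀ {i} (p : i ≤ i) → hom p ≗ id
      hom-comp   : ∀ {i j k} (p : i ≤ j) (q : j ≤ k) (r : i ≤ k) → hom q ∘ hom p ≗ hom r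

  module _ {δ : LimitOrdinal ℓ} (C : Chain δ) where
    open LimitOrdinal δ
    open Chain C

    IsContinuous : Set ℓ
    IsContinuous = ∀ j → IsLimitPoint j → ∀ (y : Carrier (obj j)) →
      ∃[ i ] Σ[ p ∈ i < j ] ∃[ x ] hom (inj₁ p) x ≡ y

    -- N is (isomorphic to) the union of the chain, as a τ-structure.
    record IsUnion (N : Structure τ) : Set ℓ where
      field
        inj           : ∀ i → Carrier (obj i) → Carrier N
        inj-embedding : ∀ i → IsEmbedding (obj i) N (inj i)
        inj-hom       : ∀ {i j} (p : i ≤ j) → inj j ∘ hom p ≗ inj i
        cover         : ∀ y → ∃[ i ] ∃[ x ] inj i x ≡ y

  -- μ is infinite, at least |τ|, and each A ⊆ N ∈ K lies in some M ≺ N with |M| ≤ |A| + μ.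
  record IsLSCardinal (μ : Set ℓ) : Set (suc ℓ) where
    field
      infinite            : ℕ ↣ μ
      signature-small     : (FunSym ⊎ RelSym) ↣ μ
      downward-LS         : ∀ N → Member N → (A : Set ℓ) (ι : A ↣ Carrier N) →
        ∃[ M ] Σ[ f ∈ (Carrier M → Carrier N) ]
          Strong M N f
          × (∀ a → ∃[ x ] f x ≡ Injection.to ι a)
          × (Carrier M ↣ (A ⊎ μ))

  record IsAEC : Set (suc ℓ) where
    field
      strong-member    : ∀ {M N f} → Strong M N f → Member M × Member N
      strong-embedding : ∀ {M N f} → Strong M N f → IsEmbedding M N f
      -- Closure under isomorphism, and (for the identity) reflexivity of ≺.
      iso-closed       : ∀ {M N} (φ : M ≅ N) → Member M → Member N × Strong M N (to φ)
      strong-trans     : ∀ {M N P f g} → Strong M N f → Strong N P g → Strong M P (g ∘ f)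
      coherence        : ∀ {M N P f g} → IsEmbedding M N f → Strong N P g →
                         Strong M P (g ∘ f) → Strong M N f
      union-strong     : ∀ {δ} (C : Chain δ) {N} (U : IsUnion C N) →
                         Member N × (∀ i → Strong (Chain.obj C i) N (IsUnion.inj U i))
      union-smooth     : ∀ {δ} (C : Chain δ) {N} (U : IsUnion C N) →
                         ∀ P → Member P → (h : Carrier N → Carrier P) →
                         (∀ i → Strong (Chain.obj C i) P (h ∘ IsUnion.inj U i)) →
                         Strong N P h
      LS               : Set ℓ
      LS-isLS          : IsLSCardinal LS
      LS-least         : ∀ μ → IsLSCardinal μ → LS ↣ μ

record AEC (ℓ : Level) : Set (suc (suc ℓ)) where
  field
    abstractClass : AbstractClass ℓ
    isAEC         : IsAEC abstractClass
  open AbstractClass abstractClass public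
  open IsAEC isAEC public

module _ {ℓ} (K : AEC ℓ) (Λ : Set ℓ) where
  open AEC K

  record Model : Set (suc ℓ) where
    field
      structure : Structure τ
      member    : Member structure
      size      : Carrier structure ↔ Λ

module _ {ℓ} {K : AEC ℓ} {Λ : Set ℓ} where
  open AEC K
  open Model

  ∣_∣ : Model K Λ → Set ℓ
  ∣ M ∣ = Carrier (structure M)

  infix 4 _↪_ _≃_
  infixr 9 _⊙_

  record _↪_ (M N : Model K Λ) : Set (suc ℓ) where
    constructor mk↪
    field
      ⟦_⟧    : ∣ M ∣ → ∣ N ∣
      strong : Strong (structure M) (structure N) ⟦_⟧

  open _↪_ public

  _≃_ : Model K Λ → Model K Λ → Set ℓ
  M ≃ N = structure M ≅ structure N

  iso↪ : ∀ {M N} → M ≃ N → M ↪ N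
  iso↪ {M} φ = mk↪ (to φ) (proj₂ (iso-closed φ (member M)))

  id↪ : ∀ {M} → M ↪ M
  id↪ {M} = iso↪ {M} {M} (record
    { bijection   = ↔-id _
    ; isEmbedding = record
      { injective = id
      ; fun-homo  = λ f xs → cong (Structure.fun (structure M) f) (sym (map-id xs))
      ; rel-iff   = λ r xs → subst (λ ys → Structure.rel (structure M) r xs
                                            ⇔ Structure.rel (structure M) r ys)
                                   (sym (map-id xs)) (⇔-id _)
      }
    })

  _⊙_ : ∀ {M N P} → N ↪ P → M ↪ N → M ↪ P
  g ⊙ f = mk↪ (⟦ g ⟧ ∘ ⟦ f ⟧) (strong-trans (strong f) (strong g))

  -- A Galois type over M is given by a representative (a, N) with M ≺ N and a ∈ N;
  -- equality of Galois types is the relation _∼_.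
  record GaloisType (M : Model K Λ) : Set (suc ℓ) where
    constructor gtp
    field
      {model} : Model K Λ
      base    : M ↪ model
      element : ∣ model ∣

  infix 4 _∼_

  _∼_ : ∀ {M} → GaloisType M → GaloisType M → Set (suc ℓ)
  gtp {N₁} e₁ a₁ ∼ gtp {N₂} e₂ a₂ =
    ∃[ N ] Σ[ f₁ ∈ (N₁ ↪ N) ] Σ[ f₂ ∈ (N₂ ↪ N) ]
      ⟦ f₁ ⊙ e₁ ⟧ ≗ ⟦ f₂ ⊙ e₂ ⟧ × ⟦ f₁ ⟧ a₁ ≡ ⟦ f₂ ⟧ a₂

  infixl 8 _↾_

  -- Restriction along M₀ ≺ M.  Applied to an isomorphism, it transports types.
  _↾_ : ∀ {M₀ M} → GaloisType M → M₀ ↪ M → GaloisType M₀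
  gtp e a ↾ f = gtp (e ⊙ f) a

  NonAlgebraic : ∀ {M} → GaloisType M → Set (suc ℓ)
  NonAlgebraic {M} p = ¬ (∃[ b ] p ∼ gtp (id↪ {M}) b)

  -- An increasing continuous chain (Mᵢ)_{i≤δ} in K_λ; here M_δ is top.
  record ClosedChain (δ : LimitOrdinal ℓ) : Set (suc ℓ) where
    open LimitOrdinal δ
    field
      chain      : Chain abstractClass δ
      size-below : ∀ i → Carrier (Chain.obj chain i) ↔ Λ
      continuous : IsContinuous abstractClass chain
      top        : Model K Λ
      isUnion    : IsUnion abstractClass chain (structure top)

    at : Index → Model K Λ
    at i = record
      { structure = Chain.obj chain i
      ; member    = proj₁ (strong-member (Chain.hom-strong chain {i} (inj₂ refl)))
      ; size      = size-below i
      }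

    step : ∀ {i j} → i ≤ j → at i ↪ at j
    step p = mk↪ (Chain.hom chain p) (Chain.hom-strong chain p)

    toTop : ∀ i → at i ↪ top
    toTop i = mk↪ (IsUnion.inj isUnion i) (proj₂ (union-strong chain isUnion) i)

_<_⁺ : ∀ {ℓ} → LimitOrdinal ℓ → Set ℓ → Set ℓ
δ < Λ ⁺ = LimitOrdinal.Index δ ↣ Λ

module _ {ℓ} (K : AEC ℓ) (Λ : Set ℓ) where
  open AEC K
  open Model

  record IsSuperlimit (M : Model K Λ) : Set (suc ℓ) where
    field
      universal : ∀ N → N ↪ M
      extend    : ∀ N → M ↪ N →
                  ∃[ M′ ] Σ[ g ∈ (N ↪ M′) ] ¬ IsOnto ⟦ g ⟧ × M′ ≃ M
      unions    : ∀ δ → δ < Λ ⁺ → (C : Chain abstractClass δ) →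
                  (∀ i → Chain.obj C i ≅ structure M) →
                  ∀ N → IsUnion abstractClass C N → N ≅ structure M

  Amalgamation : Set (suc ℓ)
  Amalgamation = ∀ (M₀ M₁ M₂ : Model K Λ) (f₁ : M₀ ↪ M₁) (f₂ : M₀ ↪ M₂) →
    Σ[ N ∈ Model K Λ ] Σ[ g₁ ∈ (M₁ ↪ N) ] Σ[ g₂ ∈ (M₂ ↪ N) ] ⟦ g₁ ⊙ f₁ ⟧ ≗ ⟦ g₂ ⊙ f₂ ⟧

  JointEmbedding : Set (suc ℓ)
  JointEmbedding = ∀ (M₁ M₂ : Model K Λ) → Σ[ N ∈ Model K Λ ] (M₁ ↪ N) × (M₂ ↪ N)

  NoMaximal : Set (suc ℓ)
  NoMaximal = ∀ (M : Model K Λ) → Σ[ N ∈ Model K Λ ] Σ[ f ∈ (M ↪ N) ] ¬ IsOnto ⟦ f ⟧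

  record PreFrame : Set (suc (suc ℓ)) where
    field
      Basic : (M : Model K Λ) → GaloisType M → Set (suc ℓ)
      -- Nonforking f g a is  a ↓_{M₀}^{M₃} M₁,  for M₀ ≺ M₁ ≺ M₃ given by f and g.
      Nonforking : ∀ {M₀ M₁ M₃} → M₀ ↪ M₁ → M₁ ↪ M₃ → ∣ M₃ ∣ → Set (suc ℓ)

    DoesNotFork : ∀ {M₀ M₁} → M₀ ↪ M₁ → GaloisType M₁ → Set (suc ℓ)
    DoesNotFork {M₁ = M₁} f p =
      Σ[ M₃ ∈ Model K Λ ] Σ[ g ∈ (M₁ ↪ M₃) ] ∃[ a ] p ∼ gtp g a × Nonforking f g a

  record IsGoodFrame (𝔰 : PreFrame) : Set (suc ℓ) where
    open PreFrame 𝔰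
    open ClosedChain
    open LimitOrdinal using (bottom; bottom-least)
    field
      LS≤λ               : LS ↣ Λ
      inhabited          : Model K Λ
      superlimit         : ∃[ M ] IsSuperlimit M
      amalgamation       : Amalgamation
      jointEmbedding     : JointEmbedding
      noMaximal          : NoMaximal
      basic-resp-∼       : ∀ {M p q} → p ∼ q → Basic M p → Basic M q
      basic-nonalgebraic : ∀ {M p} → Basic M p → NonAlgebraic p
      basic-iso          : ∀ {M M′} (φ : M′ ≃ M) {p} → Basic M p → Basic M′ (p ↾ iso↪ φ)
      density            : ∀ {M N} (f : M ↪ N) → ¬ IsOnto ⟦ f ⟧ →
        ∃[ a ] ¬ (∃[ x ] ⟦ f ⟧ x ≡ a) × Basic M (gtp f a)
      stability          : ∀ M → Σ[ c ∈ (∀ p → Basic M p → Λ) ]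
        (∀ p q (bp : Basic M p) (bq : Basic M q) → (c p bp ≡ c q bq) ⇔ (p ∼ q))
      ↓-iso              : ∀ {M₀ M₁ M₃ M₀′ M₁′ M₃′}
        {f : M₀ ↪ M₁} {g : M₁ ↪ M₃} {f′ : M₀′ ↪ M₁′} {g′ : M₁′ ↪ M₃′}
        (φ₀ : M₀ ≃ M₀′) (φ₁ : M₁ ≃ M₁′) (φ₃ : M₃ ≃ M₃′) →
        to φ₁ ∘ ⟦ f ⟧ ≗ ⟦ f′ ⟧ ∘ to φ₀ → to φ₃ ∘ ⟦ g ⟧ ≗ ⟦ g′ ⟧ ∘ to φ₁ →
        ∀ {a} → Nonforking f g a → Nonforking f′ g′ (to φ₃ a)
      ↓-outside          : ∀ {M₀ M₁ M₃} {f : M₀ ↪ M₁} {g : M₁ ↪ M₃} {a} →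
        Nonforking f g a → ¬ (∃[ x ] ⟦ g ⟧ x ≡ a)
      ↓-basic            : ∀ {M₀ M₁ M₃} {f : M₀ ↪ M₁} {g : M₁ ↪ M₃} {a} →
        Nonforking f g a → Basic M₀ (gtp (g ⊙ f) a) × Basic M₁ (gtp g a)
      -- The two monotonicity clauses concern M₀ ≺ M₀′ ≺ M₁′ ≺ M₁ ≺ M₃ ≺ M₃′.
      monotonicity       : ∀ {M₀ M₀′ M₁′ M₁ M₃ M₃′}
        (i₀ : M₀ ↪ M₀′) (i₁ : M₀′ ↪ M₁′) (i₂ : M₁′ ↪ M₁) (i₃ : M₁ ↪ M₃) (i₄ : M₃ ↪ M₃′) {a} →
        Nonforking (i₂ ⊙ i₁ ⊙ i₀) i₃ a → Nonforking i₁ (i₄ ⊙ i₃ ⊙ i₂) (⟦ i₄ ⟧ a)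
      -- u and b witness M₁′ ∪ {a} ⊆ M₃″; that u is strong is automatic by coherence.
      monotonicity′      : ∀ {M₀ M₀′ M₁′ M₁ M₃ M₃′ M₃″}
        (i₀ : M₀ ↪ M₀′) (i₁ : M₀′ ↪ M₁′) (i₂ : M₁′ ↪ M₁) (i₃ : M₁ ↪ M₃) (i₄ : M₃ ↪ M₃′) {a} →
        Nonforking (i₂ ⊙ i₁ ⊙ i₀) i₃ a →
        (j : M₃″ ↪ M₃′) (u : M₁′ ↪ M₃″) (b : ∣ M₃″ ∣) →
        ⟦ j ⊙ u ⟧ ≗ ⟦ i₄ ⊙ i₃ ⊙ i₂ ⟧ → ⟦ j ⟧ b ≡ ⟦ i₄ ⟧ a →
        Nonforking i₁ u b
      localCharacter     : ∀ δ → δ < Λ ⁺ → (C : ClosedChain δ) →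
        ∀ p → Basic (top C) p → ∃[ i ] DoesNotFork (toTop C i) p
      transitivity       : ∀ {M₀ M₁ M₂} (f : M₀ ↪ M₁) (g : M₁ ↪ M₂) p → Basic M₂ p →
        DoesNotFork g p → DoesNotFork f (p ↾ g) → DoesNotFork (g ⊙ f) p
      uniqueness         : ∀ {M₀ M₁} (f : M₀ ↪ M₁) p q → Basic M₁ p → Basic M₁ q →
        DoesNotFork f p → DoesNotFork f q → p ↾ f ∼ q ↾ f → p ∼ q
      symmetry           : ∀ {M₀ M₁ M₃} (f : M₀ ↪ M₁) (g : M₁ ↪ M₃)
        (a₁ : ∣ M₁ ∣) (a₂ : ∣ M₃ ∣) →
        Basic M₀ (gtp (g ⊙ f) (⟦ g ⟧ a₁)) → Nonforking f g a₂ →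
        Σ[ M₂ ∈ Model K Λ ] Σ[ M₃′ ∈ Model K Λ ]
        Σ[ h ∈ (M₀ ↪ M₂) ] Σ[ k ∈ (M₂ ↪ M₃′) ] Σ[ l ∈ (M₃ ↪ M₃′) ]
          ⟦ k ⊙ h ⟧ ≗ ⟦ l ⊙ g ⊙ f ⟧
          × (∃[ b ] ⟦ k ⟧ b ≡ ⟦ l ⟧ a₂)
          × Nonforking h k (⟦ l ⊙ g ⟧ a₁)
      extension          : ∀ {M N} (f : M ↪ N) p → Basic M p →
        ∃[ q ] Basic N q × q ↾ f ∼ p × DoesNotFork f q
      continuity         : ∀ δ → δ < Λ ⁺ → (C : ClosedChain δ) → ∀ p →
        (∀ i → Basic (at C i) (p ↾ toTop C i)
               × DoesNotFork (step C (bottom-least δ i)) (p ↾ toTop C i)) →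
        Basic (top C) p × DoesNotFork (toTop C (bottom δ)) p

  record GoodFrame : Set (suc (suc ℓ)) where
    field
      preFrame    : PreFrame
      isGoodFrame : IsGoodFrame preFrame
    open PreFrame preFrame public
    open IsGoodFrame isGoodFrame public

module _ {ℓ} {K : AEC ℓ} {Λ : Set ℓ} where

  module _ (𝔰 : GoodFrame K Λ) where
    open GoodFrame 𝔰

    -- An amalgam of M₁ and N over M in which the image of a does not fork over M.
    record NonforkingAmalgam {M N M₁ : Model K Λ}
                             (e : M ↪ N) (a : ∣ N ∣) (m : M ↪ M₁) : Set (suc ℓ) where
      field
        target     : Model K Λ
        f          : M₁ ↪ target
        g          : N ↪ target
        commutes   : ⟦ f ⊙ m ⟧ ≗ ⟦ g ⊙ e ⟧
        nonforking : DoesNotFork m (gtp f (⟦ g ⟧ a))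

    open NonforkingAmalgam using (target; f; g)

    -- The triple (a, M, N), with M ≺ N given by e.
    IsUniquenessTriple : ∀ {M N : Model K Λ} → M ↪ N → ∣ N ∣ → Set (suc ℓ)
    IsUniquenessTriple {M} e a =
      Basic M (gtp e a) ×
      (∀ {M₁} (m : M ↪ M₁) (A₁ A₂ : NonforkingAmalgam e a m) →
        Σ[ N* ∈ Model K Λ ] Σ[ h₁ ∈ (target A₁ ↪ N*) ] Σ[ h₂ ∈ (target A₂ ↪ N*) ]
          ⟦ h₁ ⊙ f A₁ ⟧ ≗ ⟦ h₂ ⊙ f A₂ ⟧ × ⟦ h₁ ⊙ g A₁ ⟧ ≗ ⟦ h₂ ⊙ g A₂ ⟧)

    WeaklySuccessful : Set (suc ℓ)
    WeaklySuccessful = ∀ M p → Basic M p →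
      Σ[ N ∈ Model K Λ ] Σ[ e ∈ (M ↪ N) ] ∃[ a ] p ∼ gtp e a × IsUniquenessTriple e a

  SameBasicTypes : GoodFrame K Λ → GoodFrame K Λ → Set (suc ℓ)
  SameBasicTypes 𝔰₁ 𝔰₂ = ∀ M p → GoodFrame.Basic 𝔰₁ M p ⇔ GoodFrame.Basic 𝔰₂ M p

  SameNonforking : GoodFrame K Λ → GoodFrame K Λ → Set (suc ℓ)
  SameNonforking 𝔰₁ 𝔰₂ = ∀ {M₀ M₁ M₃} (f : M₀ ↪ M₁) (g : M₁ ↪ M₃) (a : ∣ M₃ ∣) →
    GoodFrame.Nonforking 𝔰₁ f g a ⇔ GoodFrame.Nonforking 𝔰₂ f g a

{-# OPTIONS --safe #-}

-- Only one implication is needed, as it can be applied to both orders of the two frames: if a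
-- type is 𝔰₁-free over M then it is 𝔰₂-free over M.  An embedding M → N for which this holds
-- for all types over N is called transferring.
--
-- If (b, M, N) is a uniqueness triple of 𝔰₂, then M → N is transferring.  Take an increasing
-- sequence (Q i), i < ω, over M such that Q (i + 1) contains a copy of (b, N) independent from
-- Q i over M in the sense of 𝔰₂, and realize over the union the 𝔰₁-free extension of p ↾ M by
-- an element a.  By local character a is 𝔰₂-free over some Q i; by symmetry, the copy of b in
-- Q (i + 1) is independent from a model containing Q i and a, and now the uniqueness triple
-- determines the type of a over that copy of N: it is the 𝔰₂-free one.
--
-- Transferring embeddings are closed under composition and unions of chains, and f is
-- transferring if some g ∘ f is.  So it suffices to resolve some extension of a given M ≺ N
-- into a chain of uniqueness triples starting at M.  Along a well-order of λ (followed by a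
-- copy of ω, so as to have no last element), add each element of the big model to the small
-- one if some transferring extension permits it; repeat this ω times.  Then the small model
-- exhausts the big one, since by density and weak successfulness any remaining basic element
-- could still have been added.  All big models are the superlimit model, so that these are
-- chains of self-embeddings, whose unions again have size λ.

module Submission where

open import Defs
open import Axiom.UniquenessOfIdentityProofs.WithK using (uip)
open import Data.Bool.Base using (Bool; true; false; T)
open import Data.Bool.Properties using (T-irrelevant)
open import Data.Empty using (⊥-elim)
open import Data.Empty.Polymorphic using () renaming (⊥ to ⊥ℓ)
open import Data.Nat.Base as ℕ using (ℕ; zero; suc)
import Data.Nat.Induction as ℕ
import Data.Nat.Properties as ℕ
open import Data.Product.Base using (Σ; Σ-syntax; ∃; ∃-syntax; _×_; _,_; proj₁; proj₂)
open import Data.Sum.Base using (_⊎_; inj₁; inj₂; [_,_]′)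
open import Data.Unit.Base using (tt)
open import Data.Vec.Base as Vec using (Vec; []; _∷_)
import Data.Vec.Properties as Vec
open import Function.Base using (id; _∘_; case_of_)
open import Function.Bundles using (_↣_; _↔_; _⇔_; mk↣; mk↔ₛ′; mk⇔; Injection; Inverse; Equivalence)
open import Function.Construct.Identity using (↔-id)
open import Function.Definitions using (Injective)
open import Function.Properties.Inverse using (↔-sym; ↔⇒↣)
open import Induction.WellFounded using (WellFounded; Acc; acc)
import Induction.WellFounded as WF
open import Level using (Lift; lift)
open import Relation.Binary.Core using (Rel)
open import Relation.Binary.Definitions using (tri<; tri≈; tri>; Trichotomous; Transitive; Irrelevant)
open import Relation.Binary.PropositionalEquality hiding ([_])
open import Relation.Binary.Structures using (IsStrictTotalOrder; IsEquivalence)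
open import Relation.Binary.Structures.Biased using (isStrictTotalOrderᶜ)
open import Relation.Nullary.Decidable.Core using (Dec; yes; no; isYes; toWitness; fromWitness)
open import Relation.Nullary.Negation.Core using (¬_; contradiction)

-- Choice, quotients and the Cantor-Bernstein theorem

module Choice (cl : Classical) where
  open Classical cl

  em : ∀ {a} (P : Set a) → Dec P
  em P = excludedMiddle {P = P}

  by-contradiction : ∀ {a} {P : Set a} → ¬ ¬ P → P
  by-contradiction {P = P} ¬¬p with em P
  ... | yes p = p
  ... | no ¬p = contradiction ¬p ¬¬p

  ext : ∀ {a b} {A : Set a} {B : A → Set b} {f g : (x : A) → B x} → (∀ x → f x ≡ g x) → f ≡ g
  ext = extensionality

  -- Boolean predicates on `A` stay in the universe of `A`, and by extensionality they are equal as
  -- soon as they are equivalent.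
  ⌊_⌋ : ∀ {a} → Set a → Bool
  ⌊ P ⌋ = isYes (em P)

  ⌊⌋-intro : ∀ {a} {P : Set a} → P → T ⌊ P ⌋
  ⌊⌋-intro = fromWitness

  ⌊⌋-elim : ∀ {a} {P : Set a} → T ⌊ P ⌋ → P
  ⌊⌋-elim = toWitness

  T-injective : ∀ {b c} → (T b → T c) → (T c → T b) → b ≡ c
  T-injective {false} {false} p q = refl
  T-injective {false} {true}  p q = ⊥-elim (q tt)
  T-injective {true}  {false} p q = ⊥-elim (p tt)
  T-injective {true}  {true}  p q = refl

  choose : ∀ {a} {A : Set a} → (A → Bool) → A → A
  choose {A = A} P d with em (Σ[ x ∈ A ] T (P x))
  ... | yes (x , _) = x
  ... | no  _       = d

  choose-holds : ∀ {a} {A : Set a} (P : A → Bool) d → T (P d) → T (P (choose P d))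
  choose-holds P d p with em (∃ (T ∘ P))
  ... | yes (_ , q) = q
  ... | no  _       = p

  -- Once `P` is inhabited the default is never returned, so `choose P` is a canonical element of
  -- `P`.
  choose-default : ∀ {a} {A : Set a} (P : A → Bool) {d d′} → T (P d) → choose P d ≡ choose P d′
  choose-default P p with em (∃ (T ∘ P))
  ... | yes _ = refl
  ... | no ¬q = contradiction (_ , p) ¬q

  module Quotient {a} {A : Set a} {_≈_ : Rel A a} (isEquivalence : IsEquivalence _≈_) where
    private module E = IsEquivalence isEquivalence

    abstract
      rep : A → A
      rep x = choose (λ y → ⌊ y ≈ x ⌋) x

      rep-≈ : ∀ x → rep x ≈ x
      rep-≈ x = ⌊⌋-elim (choose-holds (λ y → ⌊ y ≈ x ⌋) x (⌊⌋-intro E.refl))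

      -- Equivalent points have equal classes as Boolean predicates, and the choice depends only on
      -- the predicate.
      rep-cong : ∀ {x y} → x ≈ y → rep x ≡ rep y
      rep-cong {x} {y} x≈y = trans
        (cong (λ P → choose P x) (ext λ z → T-injective
          (λ p → ⌊⌋-intro (E.trans (⌊⌋-elim p) x≈y))
          (λ p → ⌊⌋-intro (E.trans (⌊⌋-elim p) (E.sym x≈y)))))
        (choose-default _ (⌊⌋-intro x≈y))

    Quot : Set a
    Quot = Σ[ x ∈ A ] rep x ≡ x

    Quot-≡ : {p q : Quot} → proj₁ p ≡ proj₁ q → p ≡ q
    Quot-≡ {_ , p} {_ , q} refl = cong (_ ,_) (uip p q)

    abstract
      cls : A → Quot
      cls x = rep x , rep-cong (rep-≈ x)

      cls-cong : ∀ {x y} → x ≈ y → cls x ≡ cls y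
      cls-cong x≈y = Quot-≡ (rep-cong x≈y)

      cls-effective : ∀ {x y} → cls x ≡ cls y → x ≈ y
      cls-effective {x} {y} eq =
        E.trans (E.sym (rep-≈ x)) (subst (_≈ y) (sym (cong proj₁ eq)) (rep-≈ y))

      cls-surjective : ∀ q → ∃[ x ] cls x ≡ q
      cls-surjective (x , p) = x , Quot-≡ p

  module _ {a} {A B : Set a} (f : A ↣ B) (g : B ↣ A) where
    open Injection f using () renaming (to to F; injective to F-injective)
    open Injection g using () renaming (to to G; injective to G-injective)

    -- The elements of A with a finite G F-ancestry that ends in A; on them the bijection
    -- is F and elsewhere it is the inverse of G.
    data Rooted : A → Set a where
      root    : ∀ {x} → ¬ (∃[ y ] G y ≡ x) → Rooted x
      descend : ∀ {x} → Rooted x → Rooted (G (F x))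

    private
      unrooted : ∀ {x} → ¬ Rooted x → ∃[ y ] G y ≡ x
      unrooted ¬r = by-contradiction (¬r ∘ root)

      to : A → B
      to x with em (Rooted x)
      ... | yes _ = F x
      ... | no ¬r = proj₁ (unrooted ¬r)

      to-rooted : ∀ {x} → Rooted x → to x ≡ F x
      to-rooted {x} r with em (Rooted x)
      ... | yes _ = refl
      ... | no ¬r = contradiction r ¬r

      to-unrooted : ∀ {x} → ¬ Rooted x → G (to x) ≡ x
      to-unrooted {x} ¬r with em (Rooted x)
      ... | yes r = contradiction r ¬r
      ... | no ¬r = proj₂ (unrooted ¬r)

      to-injective : ∀ {x y} → to x ≡ to y → x ≡ y
      to-injective {x} {y} eq with em (Rooted x) | em (Rooted y)
      ... | yes r | yes s = F-injective eq
      -- Here `y` would be `G (F x)`, which is rooted by `descend`; the next case is symmetric.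
      ... | yes r | no ¬s = contradiction (subst Rooted (trans (cong G eq) (proj₂ (unrooted ¬s))) (descend r)) ¬s
      ... | no ¬r | yes s = contradiction (subst Rooted (trans (cong G (sym eq)) (proj₂ (unrooted ¬r))) (descend s)) ¬r
      ... | no ¬r | no ¬s = trans (sym (proj₂ (unrooted ¬r))) (trans (cong G eq) (proj₂ (unrooted ¬s)))

      -- An unrooted `G y` is sent to `y`. A rooted one has the `G`-preimage `y`, so it is no root,
      -- and `F` maps the point it descends from to `y`.
      to-surjective : ∀ y → ∃[ x ] to x ≡ y
      to-surjective y with em (Rooted (G y))
      ... | no ¬r = G y , G-injective (to-unrooted ¬r)
      ... | yes r = origin r refl
        where
        origin : ∀ {z} → Rooted z → z ≡ G y → ∃[ x ] to x ≡ y
        origin (root ¬y)        eq = contradiction (y , sym eq) ¬y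
        origin (descend {x} s) eq = x , trans (to-rooted s) (G-injective eq)

    cantor-bernstein : A ↔ B
    cantor-bernstein = mk↔ₛ′ to (λ y → proj₁ (to-surjective y))
      (λ y → proj₂ (to-surjective y)) (λ x → to-injective (proj₂ (to-surjective (to x))))

-- Well-orders

-- With `irrelevant`, elements of an initial segment are equal as soon as their indices are.
record WellOrder {ℓ} (A : Set ℓ) : Set (Level.suc ℓ) where
  field
    _<_         : Rel A ℓ
    irrelevant  : Irrelevant _<_
    transitive  : Transitive _<_
    compare     : Trichotomous _≡_ _<_
    wellFounded : WellFounded _<_

module Zermelo (cl : Classical) {ℓ} (A : Set ℓ) where
  open Choice cl

  Subset : Set ℓ
  Subset = A → Bool

  infix 4 _∈_ _⊆_
  _∈_ : A → Subset → Set
  x ∈ S = T (S x)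

  _⊆_ : Subset → Subset → Set ℓ
  S ⊆ S′ = ∀ x → x ∈ S → x ∈ S′

  -- The choice below is only made from nonempty complements; x is a placeholder.
  IsNext : Subset → A → Set ℓ
  IsNext S x = choose (λ y → ⌊ ¬ y ∈ S ⌋) x ≡ x × ¬ x ∈ S

  next-unique : ∀ {S x y} → IsNext S x → IsNext S y → x ≡ y
  next-unique {S} (p , x∉S) (q , _) =
    trans (sym p) (trans (choose-default (λ y → ⌊ ¬ y ∈ S ⌋) (⌊⌋-intro x∉S)) q)

  next-exists : ∀ {S x} → ¬ x ∈ S → ∃[ y ] IsNext S y
  next-exists {S} {x} x∉S = choose P x , choose-default P (choose-holds P x Px) , ⌊⌋-elim (choose-holds P x Px)
    where
    P = λ y → ⌊ ¬ y ∈ S ⌋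
    Px = ⌊⌋-intro x∉S

  _⁺ : Subset → Subset
  (S ⁺) x = ⌊ (x ∈ S ⊎ IsNext S x) ⌋

  ⋃ : (Subset → Bool) → Subset
  ⋃ F x = ⌊ (Σ[ S ∈ Subset ] T (F S) × x ∈ S) ⌋

  -- Zermelo's tower: its members are linearly ordered by inclusion, and below b, the largest
  -- member omitting b, is the set of predecessors of b in the resulting well-order.
  data Tower : Subset → Set ℓ where
    union : ∀ F → (∀ S → T (F S) → Tower S) → Tower (⋃ F)
    next  : ∀ {S} → Tower S → Tower (S ⁺)

  ⊆-⁺ : ∀ S → S ⊆ S ⁺
  ⊆-⁺ S x = ⌊⌋-intro ∘ inj₁

  ⊆-antisym : ∀ {S S′} → S ⊆ S′ → S′ ⊆ S → S ≡ S′
  ⊆-antisym p q = ext λ x → T-injective (p x) (q x)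

  -- Induction on both towers. At `next` with `S ⊆ S′` the arguments are exchanged: either `S ⁺`
  -- still lies in `S′`, or the two sets are equal.
  linear : ∀ {S S′} → Tower S → Tower S′ → S ⊆ S′ ⊎ S′ ⁺ ⊆ S
  linear {S′ = S′} (union F t) t′ with em (∃[ S ] Σ[ p ∈ T (F S) ] S′ ⁺ ⊆ S)
  ... | yes (S , p , S′⁺⊆S) = inj₂ λ x x∈ → ⌊⌋-intro (S , p , S′⁺⊆S x x∈)
  ... | no ¬p = inj₁ λ x x∈ → case ⌊⌋-elim {P = Σ[ S ∈ Subset ] T (F S) × x ∈ S} x∈ of λ where
    (S , p , x∈S) → case linear (t S p) t′ of λ where
      (inj₁ S⊆S′)  → S⊆S′ x x∈S
      (inj₂ S′⁺⊆S) → contradiction (S , p , S′⁺⊆S) ¬p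
  linear {S′ = S′} (next {S} t) t′ with linear t t′
  ... | inj₂ S′⁺⊆S = inj₂ λ x → ⊆-⁺ S x ∘ S′⁺⊆S x
  ... | inj₁ S⊆S′ with linear t′ t
  ...   | inj₂ S⁺⊆S′ = inj₁ S⁺⊆S′
  ...   | inj₁ S′⊆S with ⊆-antisym S⊆S′ S′⊆S
  ...     | refl = inj₂ λ x → id

  below : A → Subset
  below b = ⋃ λ S → ⌊ Tower S × ¬ b ∈ S ⌋

  below-tower : ∀ b → Tower (below b)
  below-tower b = union _ λ S → proj₁ ∘ ⌊⌋-elim

  below-greatest : ∀ {b S} → Tower S → ¬ b ∈ S → S ⊆ below b
  below-greatest {S = S} t b∉S x x∈S = ⌊⌋-intro (S , ⌊⌋-intro (t , b∉S) , x∈S)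

  ∉-below : ∀ b → ¬ b ∈ below b
  ∉-below b b∈ with ⌊⌋-elim {P = Σ[ S ∈ Subset ] T ⌊ Tower S × ¬ b ∈ S ⌋ × b ∈ S} b∈
  ... | S , p , b∈S = proj₂ (⌊⌋-elim {P = Tower S × ¬ b ∈ S} p) b∈S

  -- If `below b ⁺` omitted `b`, it would be contained in `below b`, although it has a new point. So
  -- `b` is that new point.
  next-below : ∀ b → IsNext (below b) b
  next-below b with em (b ∈ below b ⁺)
  ... | yes b∈ = [ (λ p → contradiction p (∉-below b)) , id ]′ (⌊⌋-elim b∈)
  ... | no b∉ with next-exists (∉-below b)
  ...   | y , p = contradiction (below-greatest (next (below-tower b)) b∉ y (⌊⌋-intro (inj₂ p))) (proj₂ p)

  below-least : ∀ {b S} → Tower S → b ∈ S → below b ⁺ ⊆ S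
  below-least {b} t b∈S with linear t (below-tower b)
  ... | inj₁ S⊆ = contradiction (S⊆ b b∈S) (∉-below b)
  ... | inj₂ q  = q

  ∈-below⁺ : ∀ b → b ∈ below b ⁺
  ∈-below⁺ b = ⌊⌋-intro (inj₂ (next-below b))

  below-injective : ∀ {a b} → below a ≡ below b → a ≡ b
  below-injective {a} {b} eq = next-unique (next-below a) (subst (λ S → IsNext S b) (sym eq) (next-below b))

  infix 4 _<_
  _<_ : Rel A ℓ
  a < b = Lift ℓ (a ∈ below b)

  <-trans : Transitive _<_
  <-trans {a} {b} {c} (lift a<b) (lift b<c) =
    lift (below-least (below-tower c) b<c a (⊆-⁺ (below b) a a<b))

  <-irrefl : ∀ {a} → ¬ a < a
  <-irrefl (lift a<a) = ∉-below _ a<a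

  <-connex : ∀ a b → a < b ⊎ a ≡ b ⊎ b < a
  <-connex a b with linear (below-tower a) (below-tower b)
  ... | inj₂ p = inj₂ (inj₂ (lift (p b (∈-below⁺ b))))
  ... | inj₁ p with linear (below-tower b) (below-tower a)
  ...   | inj₂ q = inj₁ (lift (q a (∈-below⁺ a)))
  ...   | inj₁ q = inj₂ (inj₁ (below-injective (⊆-antisym p q)))

  <-compare : Trichotomous _≡_ _<_
  <-compare a b with <-connex a b
  ... | inj₁ a<b         = tri< a<b (λ { refl → <-irrefl a<b }) (λ b<a → <-irrefl (<-trans a<b b<a))
  ... | inj₂ (inj₁ refl) = tri≈ <-irrefl refl <-irrefl
  ... | inj₂ (inj₂ b<a)  = tri> (λ a<b → <-irrefl (<-trans a<b b<a)) (λ { refl → <-irrefl b<a }) b<a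

  -- Induction on the tower. All predecessors of a point added by `next` lie in `S`: otherwise
  -- linearity would put `S ⁺`, and with it `a`, inside `below a`.
  tower-accessible : ∀ {S} → Tower S → ∀ a → a ∈ S → Acc _<_ a
  tower-accessible (union F t) a a∈ with ⌊⌋-elim {P = Σ[ S ∈ Subset ] T (F S) × a ∈ S} a∈
  ... | S , p , a∈S = tower-accessible (t S p) a a∈S
  tower-accessible (next {S} t) a a∈ with ⌊⌋-elim {P = a ∈ S ⊎ IsNext S a} a∈
  ... | inj₁ a∈S = tower-accessible t a a∈S
  ... | inj₂ a-next = acc λ {b} b<a → tower-accessible t b (in-S b b<a)
    where
    in-S : ∀ b → b < a → b ∈ S
    in-S b (lift b<a) with linear (below-tower a) t
    ... | inj₁ p = p b b<a
    ... | inj₂ q = contradiction (q a (⌊⌋-intro (inj₂ a-next))) (∉-below a)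

  wellOrder : WellOrder A
  wellOrder = record
    { _<_         = _<_
    ; irrelevant  = λ { (lift p) (lift q) → cong lift (T-irrelevant p q) }
    ; transitive  = <-trans
    ; compare     = <-compare
    ; wellFounded = λ a → tower-accessible (next (below-tower a)) a (∈-below⁺ a)
    }

-- Well-orders followed by ω

module WithOmega (cl : Classical) {ℓ} {A : Set ℓ} (W : WellOrder A) where
  open Choice cl
  private module W = WellOrder W
  infix 4 _<_

  data _<_ : Rel (A ⊎ ℕ) ℓ where
    left  : ∀ {a b} → a W.< b → inj₁ a < inj₁ b
    cross : ∀ {a n} → inj₁ a < inj₂ n
    right : ∀ {m n} → m ℕ.< n → inj₂ m < inj₂ n

  private
    <-trans : Transitive _<_
    <-trans (left p)  (left q)  = left (W.transitive p q)
    <-trans (left p)  cross     = cross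
    <-trans cross     (right q) = cross
    <-trans (right p) (right q) = right (ℕ.<-trans p q)

    <-compare : Trichotomous _≡_ _<_
    <-compare (inj₁ a) (inj₁ b) with W.compare a b
    ... | tri< p ¬q ¬r = tri< (left p) (λ { refl → ¬q refl }) (λ { (left r) → ¬r r })
    ... | tri≈ ¬p refl ¬r = tri≈ (λ { (left p) → ¬p p }) refl (λ { (left r) → ¬r r })
    ... | tri> ¬p ¬q r = tri> (λ { (left p) → ¬p p }) (λ { refl → ¬q refl }) (left r)
    <-compare (inj₁ a) (inj₂ n) = tri< cross (λ ()) (λ ())
    <-compare (inj₂ m) (inj₁ b) = tri> (λ ()) (λ ()) cross
    <-compare (inj₂ m) (inj₂ n) with ℕ.<-cmp m n
    ... | tri< p ¬q ¬r = tri< (right p) (λ { refl → ¬q refl }) (λ { (right r) → ¬r r })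
    ... | tri≈ ¬p refl ¬r = tri≈ (λ { (right p) → ¬p p }) refl (λ { (right r) → ¬r r })
    ... | tri> ¬p ¬q r = tri> (λ { (right p) → ¬p p }) (λ { refl → ¬q refl }) (right r)

    accessibleˡ : ∀ {a} → Acc W._<_ a → Acc _<_ (inj₁ a)
    accessibleˡ (acc rs) = acc λ { (left p) → accessibleˡ (rs p) }

    accessibleʳ : ∀ {n} → Acc ℕ._<_ n → Acc _<_ (inj₂ n)
    accessibleʳ (acc rs) = acc λ where
      cross     → accessibleˡ (W.wellFounded _)
      (right p) → accessibleʳ (rs p)

    isSTO : IsStrictTotalOrder _≡_ _<_
    isSTO = isStrictTotalOrderᶜ record
      { isEquivalence = isEquivalence ; trans = <-trans ; compare = <-compare }

    _≤_ : Rel (A ⊎ ℕ) ℓ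
    x ≤ y = x < y ⊎ x ≡ y

    abstract
      -- Which element is least depends on whether `A` is empty, so it is found by descent.
      least : ∀ {x} → Acc _<_ x → ∃[ b ] (∀ y → b ≤ y)
      least {x} (acc rs) with em (∃[ y ] y < x)
      ... | yes (y , y<x) = least (rs y<x)
      ... | no ¬y = x , λ z → case <-compare x z of λ where
        (tri< p _ _) → inj₁ p
        (tri≈ _ q _) → inj₂ q
        (tri> _ _ r) → contradiction (_ , r) ¬y

    wf : WellFounded _<_
    wf (inj₁ a) = accessibleˡ (W.wellFounded a)
    wf (inj₂ n) = accessibleʳ (ℕ.<-wellFounded n)

  withω : LimitOrdinal ℓ
  withω = record
    { Index              = A ⊎ ℕ
    ; _<_                = _<_
    ; isStrictTotalOrder = isSTO
    ; wellFounded        = wf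
    ; bottom             = proj₁ (least (wf (inj₂ 0)))
    ; bottom-least       = proj₂ (least (wf (inj₂ 0)))
    ; no-last            = λ where
        (inj₁ a) → inj₂ 0 , cross
        (inj₂ n) → inj₂ (suc n) , right ℕ.≤-refl
    }

  withω-irrelevant : Irrelevant (LimitOrdinal._<_ withω)
  withω-irrelevant (left p)  (left q)  = cong left (W.irrelevant p q)
  withω-irrelevant cross     cross     = refl
  withω-irrelevant (right p) (right q) = cong right (ℕ.<-irrelevant p q)

open WithOmega using (withω; withω-irrelevant; left; cross; right)

⊥-wellOrder : ∀ {ℓ} → WellOrder {ℓ} ⊥ℓ
⊥-wellOrder = record
  { _<_         = λ ()
  ; irrelevant  = λ { {()} }
  ; transitive  = λ { {()} }
  ; compare     = λ ()
  ; wellFounded = λ ()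
  }

-- As the case of an empty `A`, ω shares all lemmas about `withω`.
ω : Classical → ∀ {ℓ} → LimitOrdinal ℓ
ω cl = withω cl ⊥-wellOrder

ω-no-limit-points : ∀ (cl : Classical) {ℓ} j → ¬ LimitOrdinal.IsLimitPoint (ω cl {ℓ}) j
ω-no-limit-points cl (inj₂ zero)    ((inj₂ _ , right ()) , _)
ω-no-limit-points cl (inj₂ (suc n)) (_ , dense) with dense (inj₂ n) (right ℕ.≤-refl)
... | inj₂ k , right n<k , right k<1+n = ℕ.<-irrefl refl (ℕ.<-≤-trans n<k (ℕ.≤-pred k<1+n))

module _ (cl : Classical) {ℓ} {A : Set ℓ} (ι : ℕ ↣ A) where
  open Choice cl
  open Injection ι using () renaming (to to at; injective to at-injective)

  private
    double : ℕ → ℕ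
    double n = n ℕ.+ n

    double-injective : ∀ {m n} → double m ≡ double n → m ≡ n
    double-injective {zero} {zero} _ = refl
    double-injective {suc m} {suc n} eq =
      cong suc (double-injective (ℕ.suc-injective (trans (sym (ℕ.+-suc m m)) (trans (ℕ.suc-injective eq) (ℕ.+-suc n n)))))

    even≢odd : ∀ m n → double m ≢ suc (double n)
    even≢odd (suc m) zero eq = case trans (sym (ℕ.+-suc m m)) (ℕ.suc-injective eq) of λ ()
    even≢odd (suc m) (suc n) eq =
      even≢odd m n (ℕ.suc-injective (trans (sym (ℕ.+-suc m m)) (trans (ℕ.suc-injective eq) (cong suc (ℕ.+-suc n n)))))

    -- Hilbert's hotel: the points `at n` move to even places and the copy of ℕ takes the odd ones.
    to : A ⊎ ℕ → A
    to (inj₂ n) = at (suc (double n))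
    to (inj₁ a) with em (∃[ n ] at n ≡ a)
    ... | yes (n , _) = at (double n)
    ... | no _        = a

    to-injective : ∀ {x y} → to x ≡ to y → x ≡ y
    to-injective {inj₂ m} {inj₂ n} eq = cong inj₂ (double-injective (ℕ.suc-injective (at-injective eq)))
    to-injective {inj₁ a} {inj₂ n} eq with em (∃[ n ] at n ≡ a)
    ... | yes (m , _) = contradiction (at-injective eq) (even≢odd m n)
    ... | no ¬p = contradiction (_ , sym eq) ¬p
    to-injective {inj₂ n} {inj₁ a} eq with em (∃[ n ] at n ≡ a)
    ... | yes (m , _) = contradiction (at-injective (sym eq)) (even≢odd m n)
    ... | no ¬p = contradiction (_ , eq) ¬p
    to-injective {inj₁ a} {inj₁ b} eq with em (∃[ n ] at n ≡ a) | em (∃[ n ] at n ≡ b)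
    ... | yes (m , p) | yes (n , q) = cong inj₁ (trans (sym p) (trans (cong at (double-injective (at-injective eq))) q))
    ... | yes (m , p) | no ¬q = contradiction (_ , eq) ¬q
    ... | no ¬p | yes (n , q) = contradiction (_ , sym eq) ¬p
    ... | no ¬p | no ¬q = cong inj₁ eq

  absorb-ω : (A ⊎ ℕ) ↣ A
  absorb-ω = mk↣ to-injective

-- Unions of chains

open Structure using (Carrier)

module Order {ℓ} (δ : LimitOrdinal ℓ) where
  open LimitOrdinal δ public
  open IsStrictTotalOrder isStrictTotalOrder public using () renaming (trans to <-trans; compare to <-compare)

  <-irrefl : ∀ {i} → ¬ i < i
  <-irrefl = IsStrictTotalOrder.irrefl isStrictTotalOrder refl

  ≤-refl : ∀ {i} → i ≤ i
  ≤-refl = inj₂ refl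

  ≤-<-trans : ∀ {i j k} → i ≤ j → j < k → i < k
  ≤-<-trans (inj₁ p)    q = <-trans p q
  ≤-<-trans (inj₂ refl) q = q

  <-≤-trans : ∀ {i j k} → i < j → j ≤ k → i < k
  <-≤-trans p (inj₁ q)    = <-trans p q
  <-≤-trans p (inj₂ refl) = p

  ≤-trans : ∀ {i j k} → i ≤ j → j ≤ k → i ≤ k
  ≤-trans (inj₁ p)    q = inj₁ (<-≤-trans p q)
  ≤-trans (inj₂ refl) q = q

  ≮⇒≥ : ∀ {i j} → ¬ i < j → j ≤ i
  ≮⇒≥ {i} {j} i≮j with <-compare i j
  ... | tri< p _ _ = contradiction p i≮j
  ... | tri≈ _ p _ = inj₂ (sym p)
  ... | tri> _ _ p = inj₁ p

  upper : ∀ i j → ∃[ k ] i ≤ k × j ≤ k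
  upper i j with <-compare i j
  ... | tri< p _ _ = j , inj₁ p , ≤-refl
  ... | tri≈ _ refl _ = i , ≤-refl , ≤-refl
  ... | tri> _ _ p = i , ≤-refl , inj₁ p

map-injective : ∀ {a b} {A : Set a} {B : Set b} {f : A → B} → Injective _≡_ _≡_ f →
                ∀ {n} → Injective _≡_ _≡_ (Vec.map {n = n} f)
map-injective f-inj {_} {[]}     {[]}     _  = refl
map-injective f-inj {_} {x ∷ xs} {y ∷ ys} eq =
  cong₂ _∷_ (f-inj (Vec.∷-injectiveˡ eq)) (map-injective f-inj (Vec.∷-injectiveʳ eq))

module ChainUnion (cl : Classical) {ℓ} (K : AEC ℓ) {δ : LimitOrdinal ℓ}
                  (C : Chain (AEC.abstractClass K) δ) where
  open Choice cl
  open AEC K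
  open Order δ
  open Chain C
  private module S i = Structure (obj i)

  hom-injective : ∀ {i j} (p : i ≤ j) → Injective _≡_ _≡_ (hom p)
  hom-injective p = IsEmbedding.injective (strong-embedding (hom-strong p))

  -- Both maps agree after composition with the identity at `j`, whatever the two proofs of `i ≤ j`
  -- are.
  hom-irrelevant : ∀ {i j} (p q : i ≤ j) → hom p ≗ hom q
  hom-irrelevant {j = j} p q x = trans (sym (hom-id (≤-refl {j}) (hom p x))) (hom-comp p (≤-refl {j}) q x)

  Point : Set ℓ
  Point = Σ[ i ∈ Index ] Carrier (obj i)

  infix 4 _≈_
  _≈_ : Rel Point ℓ
  (i , x) ≈ (j , y) = ∃[ k ] Σ[ p ∈ i ≤ k ] Σ[ q ∈ j ≤ k ] hom p x ≡ hom q y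

  ≈-trans : ∀ {x y z} → x ≈ y → y ≈ z → x ≈ z
  ≈-trans {i , x} {j , y} {l , z} (k , p , q , eq) (k′ , p′ , q′ , eq′) with upper k k′
  ... | m , k≤m , k′≤m = m , ≤-trans p k≤m , ≤-trans q′ k′≤m , (begin
    hom (≤-trans p k≤m) x   ≡⟨ hom-comp p k≤m (≤-trans p k≤m) x ⟨
    hom k≤m (hom p x)       ≡⟨ cong (hom k≤m) eq ⟩
    hom k≤m (hom q y)       ≡⟨ hom-comp q k≤m (≤-trans q k≤m) y ⟩
    hom (≤-trans q k≤m) y   ≡⟨ hom-comp p′ k′≤m (≤-trans q k≤m) y ⟨
    hom k′≤m (hom p′ y)     ≡⟨ cong (hom k′≤m) eq′ ⟩
    hom k′≤m (hom q′ z)     ≡⟨ hom-comp q′ k′≤m (≤-trans q′ k′≤m) z ⟩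
    hom (≤-trans q′ k′≤m) z ∎)
    where open ≡-Reasoning

  ≈-isEquivalence : IsEquivalence _≈_
  ≈-isEquivalence = record
    { refl  = λ {x} → proj₁ x , ≤-refl , ≤-refl , refl
    ; sym   = λ (k , p , q , eq) → k , q , p , sym eq
    ; trans = ≈-trans
    }

  open Quotient ≈-isEquivalence

  ι : ∀ i → Carrier (obj i) → Quot
  ι i x = cls (i , x)

  ι-hom : ∀ {i j} (p : i ≤ j) → ι j ∘ hom p ≗ ι i
  ι-hom {i} {j} p x = cls-cong {x = j , hom p x} {i , x} (j , ≤-refl , p , hom-id ≤-refl (hom p x))

  ι-injective : ∀ i → Injective _≡_ _≡_ (ι i)
  ι-injective i {x} {y} eq with cls-effective {x = i , x} {i , y} eq
  ... | k , p , q , eq′ = hom-injective p (trans eq′ (hom-irrelevant q p _))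

  ι-cover : ∀ y → ∃[ i ] ∃[ x ] ι i x ≡ y
  ι-cover y with cls-surjective y
  ... | (i , x) , eq = i , x , eq

  -- A finite tuple of the union already lives at a single stage, where functions and relations can
  -- be evaluated.
  Lift-of : ∀ {n} → Vec Quot n → Set ℓ
  Lift-of {n} ys = Σ[ i ∈ Index ] Σ[ xs ∈ Vec (Carrier (obj i)) n ] Vec.map (ι i) xs ≡ ys

  map-hom : ∀ {n i j} (p : i ≤ j) (xs : Vec _ n) → Vec.map (ι j) (Vec.map (hom p) xs) ≡ Vec.map (ι i) xs
  map-hom p xs = trans (sym (Vec.map-∘ _ _ xs)) (Vec.map-cong (ι-hom p) xs)

  lift-vec : ∀ {n} (ys : Vec Quot n) → Lift-of ys
  lift-vec [] = bottom , [] , refl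
  lift-vec (y ∷ ys) with ι-cover y | lift-vec ys
  ... | i , x , refl | j , xs , refl with upper i j
  ...   | k , p , q = k , hom p x ∷ Vec.map (hom q) xs , cong₂ _∷_ (ι-hom p x) (map-hom q xs)

  common : ∀ {n i j} {xs : Vec (Carrier (obj i)) n} {ys : Vec (Carrier (obj j)) n} →
           Vec.map (ι i) xs ≡ Vec.map (ι j) ys →
           ∃[ k ] Σ[ p ∈ i ≤ k ] Σ[ q ∈ j ≤ k ] Vec.map (hom p) xs ≡ Vec.map (hom q) ys
  common {i = i} {j} {xs} {ys} eq with upper i j
  ... | k , p , q = k , p , q ,
    map-injective (ι-injective k) (trans (map-hom p xs) (trans eq (sym (map-hom q ys))))

  open Signature τ

  fun-at : ∀ f {ys : Vec Quot (funArity f)} → Lift-of ys → Quot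
  fun-at f (i , xs , _) = ι i (S.fun i f xs)

  fun-at-unique : ∀ f {ys} (u v : Lift-of ys) → fun-at f u ≡ fun-at f v
  fun-at-unique f (i , xs , eq) (j , ys , eq′) with common {xs = xs} {ys} (trans eq (sym eq′))
  ... | k , p , q , eq″ = begin
    ι i (S.fun i f xs)                  ≡⟨ ι-hom p _ ⟨
    ι k (hom p (S.fun i f xs))          ≡⟨ cong (ι k) (fun-homo (hom-strong p)) ⟩
    ι k (S.fun k f (Vec.map (hom p) xs)) ≡⟨ cong (ι k ∘ S.fun k f) eq″ ⟩
    ι k (S.fun k f (Vec.map (hom q) ys)) ≡⟨ cong (ι k) (fun-homo (hom-strong q)) ⟨
    ι k (hom q (S.fun j f ys))          ≡⟨ ι-hom q _ ⟩
    ι j (S.fun j f ys)                  ∎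
    where
    open ≡-Reasoning
    fun-homo : ∀ {M N h} → Strong M N h → ∀ {xs} → h (Structure.fun M f xs) ≡ Structure.fun N f (Vec.map h xs)
    fun-homo s = IsEmbedding.fun-homo (strong-embedding s) f _

  union : Structure τ
  union = record
    { Carrier = Quot
    ; fun     = λ f ys → fun-at f (lift-vec ys)
    ; rel     = λ r ys → Σ[ u ∈ Lift-of ys ] S.rel (proj₁ u) r (proj₁ (proj₂ u))
    }

  isUnion : IsUnion abstractClass C union
  isUnion = record
    { inj           = ι
    ; inj-embedding = λ i → record
      { injective = ι-injective i
      ; fun-homo  = λ f xs → fun-at-unique f (i , xs , refl) (lift-vec _)
      ; rel-iff   = λ r xs → mk⇔ (λ R → (i , xs , refl) , R)
          (λ { ((j , ys , eq) , R) → case common {xs = xs} {ys} (sym eq) of λ where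
            (k , p , q , eq′) → Equivalence.from (rel-iff (hom-strong p) r)
              (subst (S.rel k r) (sym eq′) (Equivalence.to (rel-iff (hom-strong q) r) R)) })
      }
    ; inj-hom = ι-hom
    ; cover   = ι-cover
    }
    where
    rel-iff : ∀ {M N h} → Strong M N h → ∀ r {xs} → Structure.rel M r xs ⇔ Structure.rel N r (Vec.map h xs)
    rel-iff s r = IsEmbedding.rel-iff (strong-embedding s) r _

-- Initial segments at limit points

module Segment {ℓ} (δ : LimitOrdinal ℓ) (irrelevant : Irrelevant (LimitOrdinal._<_ δ)) where
  open Order δ

  private
    Σ-≡ : ∀ {j} {k l : Σ[ k ∈ Index ] k < j} → proj₁ k ≡ proj₁ l → k ≡ l
    Σ-≡ {k = _ , p} {_ , q} refl = cong (_ ,_) (irrelevant p q)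

  segment : ∀ j → IsLimitPoint j → LimitOrdinal ℓ
  segment j ((i , i<j) , dense) = record
    { Index              = Σ[ k ∈ Index ] k < j
    ; _<_                = λ k l → proj₁ k < proj₁ l
    ; isStrictTotalOrder = isStrictTotalOrderᶜ record
      { isEquivalence = isEquivalence
      ; trans         = <-trans
      ; compare       = λ k l → case <-compare (proj₁ k) (proj₁ l) of λ where
          (tri< p ¬q ¬r) → tri< p (¬q ∘ cong proj₁) ¬r
          (tri≈ ¬p q ¬r) → tri≈ ¬p (Σ-≡ q) ¬r
          (tri> ¬p ¬q r) → tri> ¬p (¬q ∘ cong proj₁) r
      }
    ; wellFounded        = λ k → accessible (wellFounded (proj₁ k))
    ; bottom             = bottom , ≤-<-trans (bottom-least i) i<j
    ; bottom-least       = λ k → ≤-lift (bottom-least (proj₁ k))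
    ; no-last            = λ (k , k<j) → case dense k k<j of λ (l , k<l , l<j) → (l , l<j) , k<l
    }
    where
    ≤-lift : ∀ {k l : Σ[ k ∈ Index ] k < j} → proj₁ k ≤ proj₁ l → proj₁ k < proj₁ l ⊎ k ≡ l
    ≤-lift (inj₁ p) = inj₁ p
    ≤-lift (inj₂ q) = inj₂ (Σ-≡ q)

    accessible : ∀ {k : Σ[ k ∈ Index ] k < j} → Acc _<_ (proj₁ k) → Acc (λ k l → proj₁ k < proj₁ l) k
    accessible (acc rs) = acc λ p → accessible (rs p)

  segment-small : ∀ {Λ : Set ℓ} j lim → δ < Λ ⁺ → segment j lim < Λ ⁺
  segment-small j lim κ = mk↣ λ {k} {l} eq → Σ-≡ (Injection.injective κ eq)

module _ {ℓ} {K : AEC ℓ} {Λ : Set ℓ} where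
  open AEC K

  ≃-refl : (M : Model K Λ) → M ≃ M
  ≃-refl M = record
    { bijection   = ↔-id _
    ; isEmbedding = strong-embedding (strong (id↪ {M = M}))
    }

  ↪-injective : ∀ {M N : Model K Λ} (f : M ↪ N) → Injective _≡_ _≡_ ⟦ f ⟧
  ↪-injective f = IsEmbedding.injective (strong-embedding (strong f))

-- Transfinite chains of pairs of models

module Pairs (cl : Classical) {ℓ} (K : AEC ℓ) (Λ : Set ℓ)
             (M* : Model K Λ) (superlimit : IsSuperlimit K Λ M*) where
  open Choice cl
  open AEC K
  open Model
  open IsSuperlimit superlimit

  End : Set (Level.suc ℓ)
  End = M* ↪ M*

  record Sub : Set (Level.suc ℓ) where
    constructor mkSub
    field
      {small}   : Model K Λ
      inclusion : small ↪ M*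

  open Sub public

  record Over (s : End) (P P′ : Sub) : Set (Level.suc ℓ) where
    constructor mkOver
    field
      lower    : small P ↪ small P′
      commutes : ⟦ inclusion P′ ⊙ lower ⟧ ≗ ⟦ s ⊙ inclusion P ⟧

  open Over public

  over-resp : ∀ {s t P P′} → ⟦ s ⟧ ≗ ⟦ t ⟧ → Over s P P′ → Over t P P′
  over-resp {P = P} s≗t (mkOver n eq) = mkOver n λ x → trans (eq x) (s≗t (⟦ inclusion P ⟧ x))

  -- Inclusions are injective. Hence every commuting diagram of small models follows from the
  -- corresponding one of big models.
  over-unique : ∀ {s P P′} (m n : Over s P P′) → ⟦ lower m ⟧ ≗ ⟦ lower n ⟧
  over-unique {P′ = P′} (mkOver m p) (mkOver n q) x = ↪-injective (inclusion P′) (trans (p x) (sym (q x)))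

  over-comp : ∀ {s t P P′ P″} → Over t P′ P″ → Over s P P′ → Over (t ⊙ s) P P″
  over-comp {t = t} (mkOver n eq) (mkOver m eq′) = mkOver (n ⊙ m) λ x → trans (eq (⟦ m ⟧ x)) (cong ⟦ t ⟧ (eq′ x))

  over-id : ∀ {s P} → ⟦ s ⟧ ≗ id → Over s P P
  over-id {P = P} s≗id = mkOver id↪ λ x → sym (s≗id (⟦ inclusion P ⟧ x))

  record Step (P : Sub) : Set (Level.suc ℓ) where
    field
      move   : End
      target : Sub
      moves  : Over move P target

  open Step public

  -- hom i j is meaningful only for i ≤ j.
  record IsPairChain (δ : LimitOrdinal ℓ) (pair : LimitOrdinal.Index δ → Sub)
                     (hom : (i j : LimitOrdinal.Index δ) → End) : Set (Level.suc ℓ) where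
    open LimitOrdinal δ
    field
      hom-id   : ∀ i → ⟦ hom i i ⟧ ≗ id
      hom-comp : ∀ {i j k} → i ≤ j → j ≤ k → ⟦ hom j k ⊙ hom i j ⟧ ≗ ⟦ hom i k ⟧
      over     : ∀ {i j} → i ≤ j → Over (hom i j) (pair i) (pair j)

    bigChain : Chain abstractClass δ
    bigChain = record
      { obj        = λ _ → structure M*
      ; hom        = λ {i} {j} _ → ⟦ hom i j ⟧
      ; hom-strong = λ {i} {j} _ → strong (hom i j)
      ; hom-id     = λ {i} _ → hom-id i
      ; hom-comp   = λ p q _ → hom-comp p q
      }

    smallChain : Chain abstractClass δ
    smallChain = record
      { obj        = λ i → structure (small (pair i))
      ; hom        = λ p → ⟦ lower (over p) ⟧
      ; hom-strong = λ p → strong (lower (over p))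
      ; hom-id     = λ {i} p → over-unique (over p) (over-id (hom-id i))
      ; hom-comp   = λ p q r → over-unique
          (over-resp (hom-comp p q) (over-comp (over q) (over p))) (over r)
      }

  -- Covering the small model of `apex` already makes it the top of a `ClosedChain`; a `Limit` also
  -- covers the big model.
  record Cocone {δ pair hom} (C : IsPairChain δ pair hom) : Set (Level.suc ℓ) where
    open LimitOrdinal δ
    open IsPairChain C
    field
      inj         : Index → End
      inj-hom     : ∀ {i j} → i ≤ j → ⟦ inj j ⊙ hom i j ⟧ ≗ ⟦ inj i ⟧
      apex        : Sub
      over-apex   : ∀ i → Over (inj i) (pair i) apex
      cover-small : ∀ y → ∃[ i ] ∃[ x ] ⟦ inclusion apex ⟧ y ≡ ⟦ inj i ⊙ inclusion (pair i) ⟧ x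

    closedChain : IsContinuous abstractClass smallChain → ClosedChain {K = K} {Λ} δ
    closedChain continuous = record
      { chain      = smallChain
      ; size-below = λ i → size (small (pair i))
      ; continuous = continuous
      ; top        = small apex
      ; isUnion    = record
        { inj           = λ i → ⟦ lower (over-apex i) ⟧
        ; inj-embedding = λ i → strong-embedding (strong (lower (over-apex i)))
        ; inj-hom       = λ {i} {j} p → over-unique
            (over-resp (inj-hom p) (over-comp (over-apex j) (over p))) (over-apex i)
        ; cover         = λ y → case cover-small y of λ (i , x , eq) → i , x ,
            ↪-injective (inclusion apex) (trans (commutes (over-apex i) x) (sym eq))
        }
      }

  record Limit {δ pair hom} (C : IsPairChain δ pair hom) : Set (Level.suc ℓ) where
    field
      cocone : Cocone C
    open Cocone cocone public
    field
      cover : ∀ y → ∃[ i ] ∃[ x ] ⟦ inj i ⟧ x ≡ y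

  module _ {δ pair hom} (κ : δ < Λ ⁺) (C : IsPairChain δ pair hom) where
    open LimitOrdinal δ
    open IsPairChain C
    private
      module B = ChainUnion cl K bigChain
      module S = ChainUnion cl K smallChain

      -- The superlimit property turns the union of the big models back into `M*`, so the limit is
      -- again a `Sub`.
      φ : B.union ≅ structure M*
      φ = unions δ κ bigChain (λ _ → ≃-refl M*) B.union B.isUnion

      inj : Index → End
      inj i = mk↪ (_≅_.to φ ∘ B.ι i)
        (strong-trans (proj₂ (union-strong bigChain B.isUnion) i)
                      (proj₂ (iso-closed φ (proj₁ (union-strong bigChain B.isUnion)))))

      inj-hom : ∀ {i j} → i ≤ j → ⟦ inj j ⊙ hom i j ⟧ ≗ ⟦ inj i ⟧
      inj-hom p x = cong (_≅_.to φ) (B.ι-hom p x)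

      g-at : ∀ {y} → ∃[ i ] ∃[ x ] S.ι i x ≡ y → ∣ M* ∣
      g-at (i , x , _) = ⟦ inj i ⊙ inclusion (pair i) ⟧ x

      g : Carrier S.union → ∣ M* ∣
      g y = g-at (S.ι-cover y)

      g-at-unique : ∀ {z} (u v : ∃[ i ] ∃[ x ] S.ι i x ≡ z) → g-at u ≡ g-at v
      g-at-unique (j , y , eq) (i , x , eq′) with Order.upper δ i j
      ... | k , p , q = begin
        ⟦ inj j ⟧ (⟦ inclusion (pair j) ⟧ y)                         ≡⟨ inj-hom q _ ⟨
        ⟦ inj k ⟧ (⟦ hom j k ⟧ (⟦ inclusion (pair j) ⟧ y))           ≡⟨ cong ⟦ inj k ⟧ (commutes (over q) y) ⟨
        ⟦ inj k ⟧ (⟦ inclusion (pair k) ⟧ (⟦ lower (over q) ⟧ y))    ≡⟨ cong (λ z → ⟦ inj k ⟧ (⟦ inclusion (pair k) ⟧ z)) agree ⟩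
        ⟦ inj k ⟧ (⟦ inclusion (pair k) ⟧ (⟦ lower (over p) ⟧ x))    ≡⟨ cong ⟦ inj k ⟧ (commutes (over p) x) ⟩
        ⟦ inj k ⟧ (⟦ hom i k ⟧ (⟦ inclusion (pair i) ⟧ x))           ≡⟨ inj-hom p _ ⟩
        ⟦ inj i ⟧ (⟦ inclusion (pair i) ⟧ x)                         ∎
        where
        open ≡-Reasoning
        agree : ⟦ lower (over q) ⟧ y ≡ ⟦ lower (over p) ⟧ x
        agree = S.ι-injective k (trans (S.ι-hom q y) (trans (trans eq (sym eq′)) (sym (S.ι-hom p x))))

      g-ι : ∀ i x → g (S.ι i x) ≡ ⟦ inj i ⊙ inclusion (pair i) ⟧ x
      g-ι i x = g-at-unique (S.ι-cover (S.ι i x)) (i , x , refl)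

      g-strong : Strong S.union (structure M*) g
      g-strong = union-smooth smallChain S.isUnion (structure M*) (member M*) g λ i →
        subst (Strong _ _) (ext λ x → sym (g-ι i x)) (strong (inj i ⊙ inclusion (pair i)))

      limitModel : Model K Λ
      limitModel = record
        { structure = S.union
        ; member    = proj₁ (union-strong smallChain S.isUnion)
        -- The union lies between the small model at `bottom` and `M*`, both of size `Λ`.
        ; size      = cantor-bernstein
            (mk↣ (IsEmbedding.injective (strong-embedding g-strong) ∘ Injection.injective (↔⇒↣ (size M*))))
            (mk↣ (Injection.injective (↔⇒↣ (↔-sym (size (small (pair bottom))))) ∘ S.ι-injective bottom))
        }

    abstract
      limit : Limit C
      limit = record
        { cocone = record
          { inj         = inj
          ; inj-hom     = inj-hom
          ; apex        = mkSub {limitModel} (mk↪ g g-strong)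
          ; over-apex   = λ i → mkOver (mk↪ (S.ι i) (proj₂ (union-strong smallChain S.isUnion) i)) (g-ι i)
          ; cover-small = λ y → case S.ι-cover y of λ { (i , x , refl) → i , x , g-ι i x }
          }
        ; cover = λ y → case B.ι-cover (Inverse.from (_≅_.bijection φ) y) of λ (i , x , eq) →
            i , x , trans (cong (_≅_.to φ) eq) (Inverse.strictlyInverseˡ (_≅_.bijection φ) y)
        }

-- Transfinite recursion on pairs of models

module Recursion (cl : Classical) {ℓ} (K : AEC ℓ) (Λ : Set ℓ)
                 (M* : Model K Λ) (superlimit : IsSuperlimit K Λ M*)
                 (δ : LimitOrdinal ℓ) (irrelevant : Irrelevant (LimitOrdinal._<_ δ)) (κ : δ < Λ ⁺) where
  open Choice cl
  open AEC K
  open Pairs cl K Λ M* superlimit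
  open Order δ
  open Segment δ irrelevant

  data Kind (j : Index) : Set ℓ where
    isZero  : (∀ i → ¬ i < j) → Kind j
    isSucc  : ∀ k → k < j → (∀ i → i < j → i ≤ k) → Kind j
    isLimit : IsLimitPoint j → Kind j

  kind : ∀ j → Kind j
  kind j with em (∃[ i ] i < j)
  ... | no ¬i = isZero λ i i<j → ¬i (i , i<j)
  ... | yes below with em (∃[ k ] k < j × (∀ i → i < j → i ≤ k))
  ...   | yes (k , k<j , max) = isSucc k k<j max
  ...   | no ¬max = isLimit (below , λ i i<j → by-contradiction λ ¬dense →
            ¬max (i , i<j , λ k k<j → ≮⇒≥ λ i<k → ¬dense (k , i<k , k<j)))

  -- A stage of the construction: the model at stage j is M* with the submodel pair, and maps i
  -- is the embedding of stage i ≤ j into it (the other values of maps are junk).  As all stages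
  -- have the same big model, the type of a state does not depend on the earlier ones.
  record State : Set (Level.suc ℓ) where
    field
      maps : Index → End
      pair : Sub

  open State

  -- Besides the stage and its pair, `rule` is given the map from the bottom stage.
  module _ (P₀ : Sub) (rule : Index → End → ∀ P → Step P) where

    module _ (j : Index) (F : ∀ k → k < j → State) where

      segmentPair : Σ[ k ∈ Index ] k < j → Sub
      segmentPair (k , p) = pair (F k p)

      segmentHom : Σ[ k ∈ Index ] k < j → Σ[ k ∈ Index ] k < j → End
      segmentHom (k , _) (l , q) = maps (F l q) k

      succState : ∀ k → k < j → State
      succState k p = record
        { maps = λ i → case i ≟ j of λ where
            (yes _) → id↪
            (no _)  → move step ⊙ maps (F k p) i
        ; pair = target step
        }
        where
        open IsStrictTotalOrder isStrictTotalOrder using (_≟_)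
        step = rule k (maps (F k p) bottom) (pair (F k p))

      limitState : ∀ lim → IsPairChain (segment j lim) segmentPair segmentHom → State
      limitState lim c = record
        { maps = λ i → case em (i < j) of λ where
            (yes p) → L.inj (i , p)
            (no _)  → id↪
        ; pair = L.apex
        }
        where module L = Limit (limit (segment-small j lim κ) c)

      constState : State
      constState = record { maps = λ _ → id↪ ; pair = P₀ }

      nextState : Kind j → State
      nextState (isZero _) = constState
      nextState (isSucc k p _) = succState k p
      -- Coherence of the earlier stages is proved only after the recursion, so here it is decided;
      -- `good-next` rules out the junk value.
      nextState (isLimit lim) = case em (IsPairChain (segment j lim) segmentPair segmentHom) of λ where
        (yes c) → limitState lim c
        (no _)  → constState

    private
      module Fix = WF.FixPoint wellFounded (λ _ → State) (λ j F → nextState j (λ k p → F {k} p) (kind j))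
        (λ j eq → cong (λ F → nextState j F (kind j)) (ext λ k → ext λ p → eq {k} p))

    abstract
      state : Index → State
      state = WF.All.wfRec wellFounded _ (λ _ → State) (λ j F → nextState j (λ k p → F {k} p) (kind j))

      state-unfold : ∀ j → state j ≡ nextState j (λ k _ → state k) (kind j)
      state-unfold j = Fix.unfold-wfRec {j}

    H : Index → Index → End
    H i j = maps (state j) i

    P : Index → Sub
    P j = pair (state j)

    -- Stated for any candidate `s`, so that it can be proved for `nextState` and then transported
    -- along `state-unfold`.
    record Coherent (j : Index) (s : State) : Set (Level.suc ℓ) where
      field
        coh-id   : ⟦ maps s j ⟧ ≗ id
        coh-comp : ∀ {i k} → i ≤ k → k < j → ⟦ maps s k ⊙ H i k ⟧ ≗ ⟦ maps s i ⟧
        coh-over : ∀ {k} → k < j → Over (maps s k) (P k) (pair s)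

    data View (j : Index) (s : State) : Set (Level.suc ℓ) where
      isZero  : (∀ i → ¬ i < j) → pair s ≡ P₀ → View j s
      isSucc  : ∀ k → k < j → (∀ i → i < j → i ≤ k) →
              ⟦ maps s k ⟧ ≗ ⟦ move (rule k (H bottom k) (P k)) ⟧ →
              pair s ≡ target (rule k (H bottom k) (P k)) → View j s
      isLimit : IsLimitPoint j →
              (∀ y → ∃[ i ] i < j × ∃[ x ] ⟦ inclusion (pair s) ⟧ y ≡ ⟦ maps s i ⊙ inclusion (P i) ⟧ x) → View j s

    Good : Index → State → Set (Level.suc ℓ)
    Good j s = Coherent j s × View j s

    private
      F : ∀ j k → k < j → State
      F j k _ = state k

    module _ {j} (ih : ∀ {k} → k < j → Good k (state k)) where
      private module C {k} p = Coherent (proj₁ (ih {k} p))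

      comp-below : ∀ {i k l} → i ≤ k → k ≤ l → l < j → ⟦ H k l ⊙ H i k ⟧ ≗ ⟦ H i l ⟧
      comp-below p (inj₁ q)    l<j = C.coh-comp l<j p q
      comp-below {i} {k} p (inj₂ refl) l<j = λ x → C.coh-id l<j (⟦ H i k ⟧ x)

      over-below : ∀ {k l} → k ≤ l → l < j → Over (H k l) (P k) (P l)
      over-below (inj₁ q)    l<j = C.coh-over l<j q
      over-below (inj₂ refl) l<j = over-id (C.coh-id l<j)

      project-≤ : ∀ {k l : Σ[ k ∈ Index ] k < j} → proj₁ k < proj₁ l ⊎ k ≡ l → proj₁ k ≤ proj₁ l
      project-≤ (inj₁ p)    = inj₁ p
      project-≤ (inj₂ refl) = ≤-refl

      segmentChain : ∀ lim → IsPairChain (segment j lim) (segmentPair j (F j)) (segmentHom j (F j))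
      segmentChain lim = record
        { hom-id   = λ (k , p) → C.coh-id p
        ; hom-comp = λ {_} {_} {l} p q → comp-below (project-≤ p) (project-≤ q) (proj₂ l)
        ; over     = λ {_} {l} p → over-below (project-≤ p) (proj₂ l)
        }

      good-next : ∀ κ → Good j (nextState j (F j) κ)
      good-next (isZero none) = record
        { coh-id   = λ _ → refl
        ; coh-comp = λ _ k<j → contradiction k<j (none _)
        ; coh-over = λ k<j → contradiction k<j (none _)
        } , isZero none refl
      good-next (isSucc k k<j max) = record
        { coh-id   = maps-self
        ; coh-comp = comp
        ; coh-over = λ {i} i<j → over-resp (λ x → sym (maps-below i<j x))
            (over-comp (moves step) (over-below (max i i<j) k<j))
        } , isSucc k k<j max (λ x → trans (maps-below k<j x) (cong ⟦ move step ⟧ (C.coh-id k<j x))) refl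
        where
        open IsStrictTotalOrder isStrictTotalOrder using (_≟_)
        step = rule k (H bottom k) (P k)

        s : State
        s = succState j (F j) k k<j

        maps-self : ⟦ maps s j ⟧ ≗ id
        maps-self x with j ≟ j
        ... | yes _ = refl
        ... | no ¬p = contradiction refl ¬p

        maps-below : ∀ {i} → i < j → ⟦ maps s i ⟧ ≗ ⟦ move step ⊙ H i k ⟧
        maps-below {i} i<j x with i ≟ j
        ... | yes refl = contradiction i<j <-irrefl
        ... | no _     = refl

        comp : ∀ {i l} → i ≤ l → l < j → ⟦ maps s l ⊙ H i l ⟧ ≗ ⟦ maps s i ⟧
        comp {i} {l} i≤l l<j x = trans (maps-below l<j _)
          (trans (cong ⟦ move step ⟧ (comp-below i≤l (max l l<j) k<j x))
                 (sym (maps-below (≤-<-trans i≤l l<j) x)))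
      good-next (isLimit lim) with em (IsPairChain (segment j lim) (segmentPair j (F j)) (segmentHom j (F j)))
      ... | no ¬c = contradiction (segmentChain lim) ¬c
      ... | yes c = record
        { coh-id   = maps-self
        ; coh-comp = comp
        ; coh-over = λ {i} i<j → over-resp (λ x → sym (maps-below i<j x)) (L.over-apex (i , i<j))
        } , isLimit lim λ y → case L.cover-small y of λ ((i , i<j) , x , eq) →
              i , i<j , x , trans eq (sym (maps-below i<j _))
        where
        module L = Limit (limit (segment-small j lim κ) c)

        s : State
        s = limitState j (F j) lim c

        maps-self : ⟦ maps s j ⟧ ≗ id
        maps-self x with em (j < j)
        ... | yes p = contradiction p <-irrefl
        ... | no _  = refl

        maps-below : ∀ {i} (p : i < j) → ⟦ maps s i ⟧ ≗ ⟦ L.inj (i , p) ⟧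
        maps-below {i} i<j x with em (i < j)
        ... | yes p = cong (λ q → ⟦ L.inj (i , q) ⟧ x) (irrelevant p i<j)
        ... | no ¬p = contradiction i<j ¬p

        lift-≤ : ∀ {i k} (p : i < j) (q : k < j) → i ≤ k → i < k ⊎ (i , p) ≡ (k , q)
        lift-≤ p q (inj₁ r)    = inj₁ r
        lift-≤ p q (inj₂ refl) = inj₂ (cong (_ ,_) (irrelevant p q))

        comp : ∀ {i k} → i ≤ k → k < j → ⟦ maps s k ⊙ H i k ⟧ ≗ ⟦ maps s i ⟧
        comp {i} {k} i≤k k<j x = trans (maps-below k<j _)
          (trans (L.inj-hom (lift-≤ (≤-<-trans i≤k k<j) k<j i≤k) x) (sym (maps-below _ x)))

    abstract
      good : ∀ j → Good j (state j)
      good = WF.All.wfRec wellFounded _ (λ j → Good j (state j)) λ j ih →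
        subst (Good j) (sym (state-unfold j)) (good-next ih (kind j))

    view : ∀ j → View j (state j)
    view j = proj₂ (good j)

    isPairChain : IsPairChain δ P H
    isPairChain = record
      { hom-id   = λ i → Coherent.coh-id (proj₁ (good i))
      -- `comp-below` wants a bound above `k`, and `no-last` supplies one.
      ; hom-comp = λ {_} {_} {k} p q → comp-below (λ _ → good _) p q (proj₂ (no-last k))
      ; over     = λ {_} {k} p → over-below (λ _ → good _) p (proj₂ (no-last k))
      }

    open IsPairChain isPairChain

    cover-limit : ∀ j → IsLimitPoint j →
      ∀ y → ∃[ i ] i < j × ∃[ x ] ⟦ inclusion (P j) ⟧ y ≡ ⟦ H i j ⊙ inclusion (P i) ⟧ x
    cover-limit j ((i , i<j) , dense) with view j
    ... | isZero none _ = contradiction i<j (none i)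
    ... | isSucc k k<j max _ _ = case dense k k<j of λ (l , k<l , l<j) →
            contradiction (<-≤-trans k<l (max l l<j)) <-irrefl
    ... | isLimit _ cover = cover

    continuous : IsContinuous abstractClass smallChain
    continuous j lim y = case cover-limit j lim y of λ (i , p , x , eq) → i , p , x ,
      ↪-injective (inclusion (P j)) (trans (commutes (over (inj₁ p)) x) (sym eq))

    -- A limit stage is a union of the earlier ones, so invariants that pass to unions survive
    -- there.
    cocone-at : ∀ j lim → Cocone (segmentChain {j} (λ _ → good _) lim)
    cocone-at j lim = record
      { inj         = λ (i , _) → H i j
      ; inj-hom     = λ {_} {k} p → hom-comp (project-≤ {j} (λ _ → good _) p) (inj₁ (proj₂ k))
      ; apex        = P j
      ; over-apex   = λ (i , p) → over (inj₁ p)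
      ; cover-small = λ y → case cover-limit j lim y of λ (i , p , x , eq) → (i , p) , x , eq
      }

    segment-continuous : ∀ j lim → IsContinuous abstractClass (IsPairChain.smallChain (segmentChain {j} (λ _ → good _) lim))
    segment-continuous j lim (k , k<j) ((i , i<k) , dense) y =
      case cover-limit k ((proj₁ i , i<k) , λ l l<k → case dense (l , <-trans l<k k<j) l<k of λ (m , p , q) → proj₁ m , p , q) y of
      λ (i , p , x , eq) → (i , <-trans p k<j) , p , x ,
        ↪-injective (inclusion (P k)) (trans (commutes (IsPairChain.over (segmentChain {j} (λ _ → good _) lim) {i , <-trans p k<j} {k , k<j} (inj₁ p)) x) (sym eq))

    P-bottom : P bottom ≡ P₀
    P-bottom with view bottom
    ... | isZero _ eq = eq
    ... | isSucc k k<⊥ _ _ _ = contradiction (<-≤-trans k<⊥ (bottom-least k)) <-irrefl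
    ... | isLimit ((i , i<⊥) , _) _ = contradiction (<-≤-trans i<⊥ (bottom-least i)) <-irrefl

    -- Descent from any index above `k`: at a limit point or a later successor there is a smaller
    -- index above `k`, so the search ends at the immediate successor.
    successor : ∀ k → ∃[ j ] Σ[ p ∈ k < j ]
      ⟦ H k j ⟧ ≗ ⟦ move (rule k (H bottom k) (P k)) ⟧ × P j ≡ target (rule k (H bottom k) (P k))
    successor k = find (wellFounded (proj₁ (no-last k))) (proj₂ (no-last k))
      where
      find : ∀ {j} → Acc _<_ j → k < j → ∃[ j ] Σ[ p ∈ k < j ]
        ⟦ H k j ⟧ ≗ ⟦ move (rule k (H bottom k) (P k)) ⟧ × P j ≡ target (rule k (H bottom k) (P k))
      find {j} (acc rs) k<j with view j
      ... | isZero none _ = contradiction k<j (none k)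
      ... | isLimit (_ , dense) _ = case dense k k<j of λ (l , k<l , l<j) → find (rs l<j) k<l
      ... | isSucc l l<j max eq eq′ with max k k<j
      ...   | inj₁ k<l  = find (rs l<j) k<l
      ...   | inj₂ refl = j , k<j , eq , eq′

-- Nonforking in good frames

-- ∼ and DoesNotFork compute, so that their arguments cannot be inferred; hence these wrappers.
infix 4 _≈_
record _≈_ {ℓ} {K : AEC ℓ} {Λ : Set ℓ} {M : Model K Λ} (p q : GaloisType M) : Set (Level.suc ℓ) where
  constructor ≈⟨_⟩
  field equivalent : p ∼ q

open _≈_ public

module FrameLemmas {ℓ} {K : AEC ℓ} {Λ : Set ℓ} (𝔰 : GoodFrame K Λ) where
  open AEC K
  open GoodFrame 𝔰

  record Free {M₀ M₁ : Model K Λ} (f : M₀ ↪ M₁) (p : GaloisType M₁) : Set (Level.suc ℓ) where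
    constructor free
    field doesNotFork : DoesNotFork f p

  open Free public

  ≈-refl : ∀ {M : Model K Λ} {p : GaloisType M} → p ≈ p
  ≈-refl = ≈⟨ _ , id↪ , id↪ , (λ _ → refl) , refl ⟩

  ≈-sym : ∀ {M : Model K Λ} {p q : GaloisType M} → p ≈ q → q ≈ p
  ≈-sym ≈⟨ N , f , g , eq , eq′ ⟩ = ≈⟨ N , g , f , (λ x → sym (eq x)) , sym eq′ ⟩

  ≈-trans : ∀ {M : Model K Λ} {p q r : GaloisType M} → p ≈ q → q ≈ r → p ≈ r
  ≈-trans {q = gtp e b} ≈⟨ N , f , g , eq , eq′ ⟩ ≈⟨ N′ , f′ , g′ , eq₁ , eq₁′ ⟩ with amalgamation _ N N′ g f′
  ... | R , h , h′ , sq = ≈⟨ R , h ⊙ f , h′ ⊙ g′ ,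
    (λ x → trans (cong ⟦ h ⟧ (eq x)) (trans (sq (⟦ e ⟧ x)) (cong ⟦ h′ ⟧ (eq₁ x)))) ,
    trans (cong ⟦ h ⟧ eq′) (trans (sq b) (cong ⟦ h′ ⟧ eq₁′)) ⟩

  ≈-extend : ∀ {M N N′ : Model K Λ} {e : M ↪ N} {e′ : M ↪ N′} {a a′} (h : N ↪ N′) →
             ⟦ h ⊙ e ⟧ ≗ ⟦ e′ ⟧ → ⟦ h ⟧ a ≡ a′ → gtp e a ≈ gtp e′ a′
  ≈-extend h eq eq′ = ≈⟨ _ , h , id↪ , eq , eq′ ⟩

  ≈-≗ : ∀ {M N : Model K Λ} {e e′ : M ↪ N} {a} → ⟦ e ⟧ ≗ ⟦ e′ ⟧ → gtp e a ≈ gtp e′ a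
  ≈-≗ eq = ≈-extend id↪ eq refl

  ≈-↾ : ∀ {M₀ M : Model K Λ} {p q : GaloisType M} (f : M₀ ↪ M) → p ≈ q → p ↾ f ≈ q ↾ f
  ≈-↾ f ≈⟨ N , g , h , eq , eq′ ⟩ = ≈⟨ N , g , h , (λ x → eq (⟦ f ⟧ x)) , eq′ ⟩

  ↾-≗ : ∀ {M₀ M : Model K Λ} {f f′ : M₀ ↪ M} (p : GaloisType M) → ⟦ f ⟧ ≗ ⟦ f′ ⟧ → p ↾ f ≈ p ↾ f′
  ↾-≗ (gtp e a) eq = ≈-≗ λ x → cong ⟦ e ⟧ (eq x)

  basic-≈ : ∀ {M p q} → p ≈ q → Basic M p → Basic M q
  basic-≈ p≈q = basic-resp-∼ (equivalent p≈q)

  -- Invariance under identity isomorphisms lets pointwise equal embeddings replace each other.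
  nf-≗ : ∀ {M₀ M₁ M₃} {f f′ : M₀ ↪ M₁} {g g′ : M₁ ↪ M₃} {a} → ⟦ f ⟧ ≗ ⟦ f′ ⟧ → ⟦ g ⟧ ≗ ⟦ g′ ⟧ →
         Nonforking f g a → Nonforking f′ g′ a
  nf-≗ {M₀} {M₁} {M₃} p q nf = ↓-iso (≃-refl M₀) (≃-refl M₁) (≃-refl M₃) p q nf

  free-≗ : ∀ {M₀ M₁} {f f′ : M₀ ↪ M₁} {p} → ⟦ f ⟧ ≗ ⟦ f′ ⟧ → Free f p → Free f′ p
  free-≗ eq (free (N , g , a , p∼ , nf)) = free (N , g , a , p∼ , nf-≗ {g = g} eq (λ _ → refl) nf)

  free-≈ : ∀ {M₀ M₁} {f : M₀ ↪ M₁} {p q} → p ≈ q → Free f p → Free f q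
  free-≈ p≈q (free (N , g , a , p∼ , nf)) = free (N , g , a , equivalent (≈-trans (≈-sym p≈q) (≈⟨_⟩ {q = gtp g a} p∼)) , nf)

  nf⇒free : ∀ {M₀ M₁ M₃} {f : M₀ ↪ M₁} {g : M₁ ↪ M₃} {a} → Nonforking f g a → Free f (gtp g a)
  nf⇒free {g = g} {a} nf = free (_ , _ , _ , equivalent (≈-refl {p = gtp g a}) , nf)

  -- The second monotonicity clause makes nonforking independent of the representative: go up to the
  -- common extension `R` and down to the model of `a`.
  free⇒nf : ∀ {M₀ M₁ M₃} {f : M₀ ↪ M₁} {g : M₁ ↪ M₃} {a} → Free f (gtp g a) → Nonforking f g a
  free⇒nf {f = f} {g} {a} (free (N , g′ , a′ , (R , h , h′ , eq , eq′) , nf)) =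
    monotonicity′ id↪ f id↪ g′ h′ (nf-≗ (λ _ → refl) (λ _ → refl) nf) h g a eq eq′

  free-basic : ∀ {M₀ M₁} {f : M₀ ↪ M₁} {p} → Free f p → Basic M₁ p
  free-basic (free (N , g , a , p∼ , nf)) = basic-≈ (≈-sym ≈⟨ p∼ ⟩) (proj₂ (↓-basic nf))

  free-basic↾ : ∀ {M₀ M₁} {f : M₀ ↪ M₁} {p} → Free f p → Basic M₀ (p ↾ f)
  free-basic↾ {f = f} (free (N , g , a , p∼ , nf)) = basic-≈ (≈-sym (≈-↾ f ≈⟨ p∼ ⟩)) (proj₁ (↓-basic nf))

  free-base : ∀ {M₀ M₁ M₂} (f : M₀ ↪ M₁) (g : M₁ ↪ M₂) {p} → Free (g ⊙ f) p → Free g p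
  free-base f g (free (N , h , a , p∼ , nf)) = free (N , h , a , p∼ ,
    nf-≗ (λ _ → refl) (λ _ → refl) (monotonicity f g id↪ h id↪ (nf-≗ (λ _ → refl) (λ _ → refl) nf)))

  free-↾ : ∀ {M₀ M₁ M₂} (f : M₀ ↪ M₁) (g : M₁ ↪ M₂) {p} → Free (g ⊙ f) p → Free f (p ↾ g)
  free-↾ f g {p} (free (N , h , a , p∼ , nf)) = free (N , h ⊙ g , a , equivalent (≈-↾ g (≈⟨_⟩ {p = p} {gtp h a} p∼)) ,
    nf-≗ (λ _ → refl) (λ _ → refl) (monotonicity id↪ f g h id↪ (nf-≗ (λ _ → refl) (λ _ → refl) nf)))

  free-trans : ∀ {M₀ M₁ M₂} (f : M₀ ↪ M₁) (g : M₁ ↪ M₂) {p} →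
               Free g p → Free f (p ↾ g) → Free (g ⊙ f) p
  free-trans f g d d′ = free (transitivity f g _ (free-basic d) (doesNotFork d) (doesNotFork d′))

  free-unique : ∀ {M₀ M₁} (f : M₀ ↪ M₁) {p q} → Free f p → Free f q → p ↾ f ≈ q ↾ f → p ≈ q
  free-unique f d d′ eq =
    ≈⟨ uniqueness f _ _ (free-basic d) (free-basic d′) (doesNotFork d) (doesNotFork d′) (equivalent eq) ⟩

  free-extension : ∀ {M N} (f : M ↪ N) p → Basic M p → ∃[ q ] q ↾ f ≈ p × Free f q
  free-extension f p bp = case extension f p bp of λ (q , _ , eq , d) → q , ≈⟨ eq ⟩ , free d

  -- The nonforking extension of p ↾ f along an isomorphism f can only be p.
  free-iso : ∀ {M₀ M₁} (f : M₀ ↪ M₁) (f⁻¹ : M₁ ↪ M₀) → ⟦ f ⊙ f⁻¹ ⟧ ≗ id → ∀ {p} →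
             Basic M₀ (p ↾ f) → Free f p
  free-iso f f⁻¹ inv {p} bp with free-extension f (p ↾ f) bp
  ... | q , eq , d = free-≈ (≈-trans (back q) (≈-trans (≈-↾ f⁻¹ eq) (≈-sym (back p)))) d
    where
    back : ∀ r → r ≈ r ↾ f ↾ f⁻¹
    back (gtp e a) = ≈-≗ λ x → cong ⟦ e ⟧ (sym (inv x))

  open NonforkingAmalgam

  amalgam-refl : ∀ {M N} (e : M ↪ N) (b : ∣ N ∣) → Basic M (gtp e b) → NonforkingAmalgam 𝔰 e b id↪
  amalgam-refl e b basic = record
    { target     = _
    ; f          = e
    ; g          = id↪
    ; commutes   = λ _ → refl
    ; nonforking = doesNotFork (free-iso id↪ id↪ (λ _ → refl) {gtp e b} (basic-≈ (≈-≗ λ _ → refl) basic))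
    }

  amalgam-≗ : ∀ {M N M₁} {e : M ↪ N} {b : ∣ N ∣} {m m′ : M ↪ M₁} → ⟦ m ⟧ ≗ ⟦ m′ ⟧ →
              NonforkingAmalgam 𝔰 e b m → NonforkingAmalgam 𝔰 e b m′
  amalgam-≗ eq A = record
    { target     = target A
    ; f          = f A
    ; g          = g A
    ; commutes   = λ x → trans (cong ⟦ f A ⟧ (sym (eq x))) (commutes A x)
    ; nonforking = doesNotFork (free-≗ {p = gtp (f A) (⟦ g A ⟧ _)} eq (free (nonforking A)))
    }

  record Extends {M N M₁ R} {e : M ↪ N} {b : ∣ N ∣} {m : M ↪ M₁} (r : M₁ ↪ R)
                 (A : NonforkingAmalgam 𝔰 e b m) : Set (Level.suc ℓ) where
    field
      amalgam : NonforkingAmalgam 𝔰 e b (r ⊙ m)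
      into    : target A ↪ target amalgam
      f-eq    : ⟦ into ⊙ f A ⟧ ≗ ⟦ f amalgam ⊙ r ⟧
      g-eq    : ⟦ into ⊙ g A ⟧ ≗ ⟦ g amalgam ⟧

  -- The type of the copy of `b` over `M₁` is extended freely along `r`. The witness `T` that this
  -- is an extension contains `R` and the old amalgam, and by transitivity the copy of `b` is still
  -- free over `M`.
  amalgam-extend : ∀ {M N M₁ R} {e : M ↪ N} {b : ∣ N ∣} {m : M ↪ M₁} (r : M₁ ↪ R)
                   (A : NonforkingAmalgam 𝔰 e b m) → Extends r A
  amalgam-extend {e = e} {b} {m} r A
    with free-extension r (gtp (f A) (⟦ g A ⟧ b)) (free-basic (free (nonforking A)))
  ... | gtp k c , ≈⟨ T , t₁ , t₂ , eq , eq′ ⟩ , d = record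
    { amalgam = record
      { target     = T
      ; f          = t₁ ⊙ k
      ; g          = t₂ ⊙ g A
      ; commutes   = λ x → trans (eq (⟦ m ⟧ x)) (cong ⟦ t₂ ⟧ (commutes A x))
      ; nonforking = doesNotFork (free-trans m r {gtp (t₁ ⊙ k) (⟦ t₂ ⟧ (⟦ g A ⟧ b))}
          (free-≈ (≈-extend t₁ (λ _ → refl) eq′) d)
          (free-≈ {p = gtp (f A) (⟦ g A ⟧ b)} (≈-extend t₂ (λ x → sym (eq x)) refl) (free (nonforking A))))
      }
    ; into    = t₂
    ; f-eq    = λ x → sym (eq x)
    ; g-eq    = λ _ → refl
    }

  nonforking-amalgam : ∀ {M N M₁} (e : M ↪ N) (b : ∣ N ∣) → Basic M (gtp e b) →
                       (m : M ↪ M₁) → NonforkingAmalgam 𝔰 e b m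
  nonforking-amalgam e b basic m =
    amalgam-≗ {m = m ⊙ id↪} (λ _ → refl) (Extends.amalgam (amalgam-extend m (amalgam-refl e b basic)))

-- Uniqueness triples and symmetry

module UniquenessTriples {ℓ} {K : AEC ℓ} {Λ : Set ℓ} (𝔰 : GoodFrame K Λ) where
  open AEC K
  open GoodFrame 𝔰
  open FrameLemmas 𝔰
  open NonforkingAmalgam

  -- If a is free from the amalgam over M₁, then by symmetry the roles can be swapped: a lies
  -- in some M₂ ≻ M₁ such that the same copy of N forms a nonforking amalgam with M₂.
  record Swap {M N M₁ S} {e : M ↪ N} {b : ∣ N ∣} {m : M ↪ M₁}
              (A : NonforkingAmalgam 𝔰 e b m) (κ : target A ↪ S) (a : ∣ S ∣) : Set (Level.suc ℓ) where
    field
      {M₂}    : Model K Λ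
      h       : M₁ ↪ M₂
      c       : ∣ M₂ ∣
      amalgam : NonforkingAmalgam 𝔰 e b (h ⊙ m)
      l       : S ↪ target amalgam
      c-eq    : ⟦ f amalgam ⟧ c ≡ ⟦ l ⟧ a
      f-eq    : ⟦ f amalgam ⊙ h ⟧ ≗ ⟦ l ⊙ κ ⊙ f A ⟧
      g-eq    : ⟦ g amalgam ⟧ ≗ ⟦ l ⊙ κ ⊙ g A ⟧

  swap : ∀ {M N M₁ S} {e : M ↪ N} {b : ∣ N ∣} {m : M ↪ M₁}
         (A : NonforkingAmalgam 𝔰 e b m) (κ : target A ↪ S) (a : ∣ S ∣) →
         Nonforking (f A) κ a → Swap A κ a
  swap {e = e} {b} {m} A κ a nf
    with symmetry (f A) κ (⟦ g A ⟧ b) a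
           (basic-≈ {p = gtp (f A) (⟦ g A ⟧ b)} (≈-extend κ (λ _ → refl) refl)
             (free-basic (free (nonforking A)))) nf
  ... | M₂ , T , h , k , l , sq , (c , eq) , nf′ = record
    { h       = h
    ; c       = c
    ; amalgam = record
      { target     = T
      ; f          = k
      ; g          = l ⊙ κ ⊙ g A
      ; commutes   = λ x → trans (sq (⟦ m ⟧ x)) (cong ⟦ l ⊙ κ ⟧ (commutes A x))
      ; nonforking = doesNotFork (free-trans m h {gtp k (⟦ l ⊙ κ ⊙ g A ⟧ b)} (nf⇒free nf′)
          (free-≈ {p = gtp (f A) (⟦ g A ⟧ b)} (≈-extend (l ⊙ κ) (λ x → sym (sq x)) refl)
            (free (nonforking A))))
      }
    ; l       = l
    ; c-eq    = eq
    ; f-eq    = sq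
    ; g-eq    = λ _ → refl
    }

  -- Equality of the types over `M` gives a model `R` in which `c₁` and `c₂` meet. Both amalgams
  -- extend to `R`, and there the triple identifies them together with their copies of `N`.
  triple-determines : ∀ {M N M₁ M₂} {e : M ↪ N} {b : ∣ N ∣} → IsUniquenessTriple 𝔰 e b →
    {m₁ : M ↪ M₁} {m₂ : M ↪ M₂} (A₁ : NonforkingAmalgam 𝔰 e b m₁) (A₂ : NonforkingAmalgam 𝔰 e b m₂) →
    ∀ {c₁ c₂} → gtp m₁ c₁ ≈ gtp m₂ c₂ → gtp (g A₁) (⟦ f A₁ ⟧ c₁) ≈ gtp (g A₂) (⟦ f A₂ ⟧ c₂)
  triple-determines {e = e} {b} (_ , unique) {m₁} {m₂} A₁ A₂ {c₁} {c₂} ≈⟨ R , r₁ , r₂ , eq , eq′ ⟩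
    with amalgam-extend r₁ A₁ | amalgam-extend r₂ A₂
  ... | E₁ | E₂ with unique (r₁ ⊙ m₁) (Extends.amalgam E₁) (amalgam-≗ (λ x → sym (eq x)) (Extends.amalgam E₂))
  ...   | N* , h₁ , h₂ , f-eq , g-eq =
    ≈-trans {q = gtp (h₁ ⊙ g E₁.amalgam) (⟦ h₁ ⊙ f E₁.amalgam ⊙ r₁ ⟧ c₁)}
      (≈-extend (h₁ ⊙ E₁.into) (λ x → cong ⟦ h₁ ⟧ (E₁.g-eq x)) (cong ⟦ h₁ ⟧ (E₁.f-eq c₁)))
      (≈-sym (≈-extend (h₂ ⊙ E₂.into)
        (λ x → trans (cong ⟦ h₂ ⟧ (E₂.g-eq x)) (sym (g-eq x)))
        (trans (cong ⟦ h₂ ⟧ (E₂.f-eq c₂)) (trans (cong ⟦ h₂ ⊙ f E₂.amalgam ⟧ (sym eq′)) (sym (f-eq (⟦ r₁ ⟧ c₁)))))))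
    where
    module E₁ = Extends E₁
    module E₂ = Extends E₂

-- Comparison of two good frames

module Comparison (cl : Classical) {ℓ} {K : AEC ℓ} {Λ : Set ℓ} (ls : AEC.LS K ↣ Λ)
                  (𝔰₁ 𝔰₂ : GoodFrame K Λ) (same : SameBasicTypes 𝔰₁ 𝔰₂) where
  open AEC K
  module G₁ = GoodFrame 𝔰₁
  module G₂ = GoodFrame 𝔰₂
  module F₁ = FrameLemmas 𝔰₁
  module F₂ = FrameLemmas 𝔰₂
  open F₂ using (≈-trans; ≈-sym; ≈-extend; ≈-≗; ≈-↾; ↾-≗)

  basic₁₂ : ∀ {M p} → G₁.Basic M p → G₂.Basic M p
  basic₁₂ {M} {p} = Equivalence.to (same M p)

  Transfers : ∀ {M N : Model K Λ} → M ↪ N → Set (Level.suc ℓ)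
  Transfers f = ∀ p → F₁.Free f p → F₂.Free f p

  transfers-≗ : ∀ {M N : Model K Λ} {f f′ : M ↪ N} → ⟦ f ⟧ ≗ ⟦ f′ ⟧ → Transfers f → Transfers f′
  transfers-≗ eq t p d = F₂.free-≗ eq (t p (F₁.free-≗ (λ x → sym (eq x)) d))

  transfers-comp : ∀ {M₀ M₁ M₂ : Model K Λ} (f : M₀ ↪ M₁) (g : M₁ ↪ M₂) →
                   Transfers f → Transfers g → Transfers (g ⊙ f)
  transfers-comp f g tf tg p d =
    F₂.free-trans f g (tg p (F₁.free-base f g d)) (tf (p ↾ g) (F₁.free-↾ f g d))

  -- Extend `p` 𝔰₁-freely to `M₂`, transfer the extension, and restrict it back to `M₁`.
  transfers-cancel : ∀ {M₀ M₁ M₂ : Model K Λ} (f : M₀ ↪ M₁) (g : M₁ ↪ M₂) → Transfers (g ⊙ f) → Transfers f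
  transfers-cancel f g t p d with F₁.free-extension g p (F₁.free-basic d)
  ... | q , eq , d′ = F₂.free-≈ eq (F₂.free-↾ f g (t q (F₁.free-trans f g d′ (F₁.free-≈ (≈-sym eq) d))))

  transfers-iso : ∀ {M N : Model K Λ} (f : M ↪ N) (f⁻¹ : N ↪ M) → ⟦ f ⊙ f⁻¹ ⟧ ≗ id → Transfers f
  transfers-iso f f⁻¹ inv p d = F₂.free-iso f f⁻¹ inv (basic₁₂ (F₁.free-basic↾ d))

  -- Each restriction of `p` to a stage is 𝔰₁-free over `N`, hence 𝔰₂-free over `N` and over the
  -- bottom stage. Continuity of 𝔰₂ carries this to the top, and transitivity leads back to `N`.
  transfers-union : ∀ δ → δ < Λ ⁺ → (C : ClosedChain δ) →
                    let open ClosedChain C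
                        open LimitOrdinal δ
                    in
                    ∀ {N : Model K Λ} (n : N ↪ at bottom) →
                    (∀ i → Transfers (step (bottom-least i) ⊙ n)) → Transfers (toTop bottom ⊙ n)
  transfers-union δ κ C n t p d = F₂.free-trans n (toTop bottom)
    (F₂.free (proj₂ (G₂.continuity δ κ C p λ i →
      F₂.free-basic (part i) , F₂.doesNotFork (F₂.free-base n (step (bottom-least i)) (part i)))))
    (F₂.free-≗ (λ x → Chain.hom-id chain (bottom-least bottom) (⟦ n ⟧ x)) (part bottom))
    where
    open ClosedChain C
    open LimitOrdinal δ
    part : ∀ i → F₂.Free (step (bottom-least i) ⊙ n) (p ↾ toTop i)
    part i = t i (p ↾ toTop i) (F₁.free-↾ (step (bottom-least i) ⊙ n) (toTop i)
      (F₁.free-≗ (λ x → sym (IsUnion.inj-hom isUnion (bottom-least i) (⟦ n ⟧ x))) d))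

  ℕ↣Λ : ℕ ↣ Λ
  ℕ↣Λ = mk↣ (Injection.injective infinite ∘ Injection.injective ls)
    where open IsLSCardinal LS-isLS using (infinite)

  ω-small : ω cl < Λ ⁺
  ω-small = mk↣ {to = λ { (inj₂ n) → Injection.to ℕ↣Λ n }}
    λ { {inj₂ m} {inj₂ n} eq → cong inj₂ (Injection.injective ℕ↣Λ eq) }

  M* : Model K Λ
  M* = proj₁ G₂.superlimit

  superlimit : IsSuperlimit K Λ M*
  superlimit = proj₂ G₂.superlimit

  open IsSuperlimit superlimit using (universal)

  -- What the argument needs of an ω-sequence (Q i) over M with union top; the target of copy i
  -- lies in Q (i + 1), but only its embedding into top matters.
  record CopyChain {M N : Model K Λ} (e : M ↪ N) (b : ∣ N ∣) : Set (Level.suc ℓ) where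
    open NonforkingAmalgam
    field
      Index    : Set ℓ
      Q        : Index → Model K Λ
      top      : Model K Λ
      base     : ∀ i → M ↪ Q i
      inj      : ∀ i → Q i ↪ top
      w        : M ↪ top
      base-top : ∀ i → ⟦ inj i ⊙ base i ⟧ ≗ ⟦ w ⟧
      copy     : ∀ i → NonforkingAmalgam 𝔰₂ e b (base i)
      into     : ∀ i → target (copy i) ↪ top
      into-f   : ∀ i → ⟦ into i ⊙ f (copy i) ⟧ ≗ ⟦ inj i ⟧
      local    : ∀ q → G₂.Basic top q → ∃[ i ] F₂.Free (inj i) q

  module _ {M N : Model K Λ} {e : M ↪ N} {b : ∣ N ∣} (triple : IsUniquenessTriple 𝔰₂ e b)
           (C : CopyChain e b) where
    open CopyChain C
    open UniquenessTriples 𝔰₂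
    open NonforkingAmalgam

    -- The element `a` realizes the 𝔰₁-free extension of `p ↾ e` to `top`, and `a*` its 𝔰₂-free
    -- extension to `N`. The aim is that they have the same type over `N`.
    module _ {p : GaloisType N} (d : F₁.Free e p)
             {T} (k : top ↪ T) (a : ∣ T ∣) (eq : gtp k a ↾ w ≈ p ↾ e) (d₁ : F₁.Free w (gtp k a))
             {T*} (k* : N ↪ T*) (a* : ∣ T* ∣) (eq* : gtp k* a* ↾ e ≈ p ↾ e) (d* : F₂.Free e (gtp k* a*))
             (i : Index) (d₂ : F₂.Free (inj i) (gtp k a)) where
      private
        A : NonforkingAmalgam 𝔰₂ e b (base i)
        A = copy i

        v : target A ↪ top
        v = into i

        v-f : ⟦ v ⊙ f A ⟧ ≗ ⟦ inj i ⟧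
        v-f = into-f i

        over-M : ⟦ v ⊙ f A ⊙ base i ⟧ ≗ ⟦ w ⟧
        over-M x = trans (v-f (⟦ base i ⟧ x)) (base-top i x)

        N→top : N ↪ top
        N→top = v ⊙ g A

        N→top-e : ⟦ N→top ⊙ e ⟧ ≗ ⟦ w ⟧
        N→top-e x = trans (cong ⟦ v ⟧ (sym (commutes A x))) (over-M x)

        nf : G₂.Nonforking (f A) (k ⊙ v) a
        nf = F₂.free⇒nf (F₂.free-↾ (f A) v (F₂.free-≗ (λ x → sym (v-f x)) d₂))

        module S = Swap (swap A (k ⊙ v) a nf)
        -- The amalgam for `a*` is the trivial one, of `N` with `M` itself.
        module S* = Swap (swap (F₂.amalgam-refl e b (proj₁ triple)) k* a* (F₂.free⇒nf d*))

        c≈ : gtp (S.h ⊙ base i) S.c ≈ p ↾ e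
        c≈ = ≈-trans {q = gtp (S.l ⊙ k ⊙ v ⊙ f A ⊙ base i) (⟦ S.l ⟧ a)} (≈-extend (f S.amalgam) (λ x → S.f-eq (⟦ base i ⟧ x)) S.c-eq)
               (≈-trans {q = gtp (k ⊙ w) a} (≈-sym (≈-extend S.l (λ x → cong ⟦ S.l ⊙ k ⟧ (sym (over-M x))) refl)) eq)

        c*≈ : gtp (S*.h ⊙ id↪) S*.c ≈ p ↾ e
        c*≈ = ≈-trans {q = gtp (S*.l ⊙ k* ⊙ e) (⟦ S*.l ⟧ a*)} (≈-extend (f S*.amalgam) S*.f-eq S*.c-eq)
                (≈-trans {q = gtp (k* ⊙ e) a*} (≈-sym (≈-extend S*.l (λ _ → refl) refl)) eq*)

        -- After the swaps, `S.c` and `S*.c` lie in models independent from `N` and have the same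
        -- type over `M`, so the triple applies.
        same-type : gtp (k ⊙ N→top) a ≈ gtp k* a*
        same-type = ≈-trans {q = gtp (g S.amalgam) (⟦ f S.amalgam ⟧ S.c)} (≈-extend S.l (λ x → sym (S.g-eq x)) (sym S.c-eq))
          (≈-trans {q = gtp (g S*.amalgam) (⟦ f S*.amalgam ⟧ S*.c)} (triple-determines triple S.amalgam S*.amalgam (≈-trans c≈ (≈-sym c*≈)))
            (≈-sym (≈-extend S*.l (λ x → sym (S*.g-eq x)) (sym S*.c-eq))))

        -- Uniqueness in 𝔰₁: both types are 𝔰₁-free over `M` and agree there.
        restricts-to-p : gtp (k ⊙ N→top) a ≈ p
        restricts-to-p = F₁.free-unique e
          (F₁.free-↾ e N→top (F₁.free-≗ (λ x → sym (N→top-e x)) d₁)) d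
          (≈-trans {q = gtp (k ⊙ w) a} (≈-≗ λ x → cong ⟦ k ⟧ (N→top-e x)) eq)

      copies-compare : F₂.Free e p
      copies-compare = F₂.free-≈ (≈-trans (≈-sym same-type) restricts-to-p) d*

    triple-transfers : Transfers e
    triple-transfers p d =
      case F₁.free-extension w (p ↾ e) (F₁.free-basic↾ d) of λ { (gtp k a , eq , d₁) →
      case F₂.free-extension e (p ↾ e) (basic₁₂ (F₁.free-basic↾ d)) of λ { (gtp k* a* , eq* , d*) →
      case local (gtp k a) (basic₁₂ (F₁.free-basic d₁)) of λ (i , d₂) →
      copies-compare d k a eq d₁ k* a* eq* d* i d₂ } }

  module _ {M N : Model K Λ} (e : M ↪ N) (b : ∣ N ∣) (basic : G₂.Basic M (gtp e b)) where
    private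
      open Pairs cl K Λ M* superlimit
      open Recursion cl K Λ M* superlimit (ω cl) (withω-irrelevant cl ⊥-wellOrder) ω-small
      open Order (ω cl {ℓ})
      open NonforkingAmalgam

      u₀ : M ↪ M*
      u₀ = universal M

      copy : (u : End) → NonforkingAmalgam 𝔰₂ e b (u ⊙ u₀)
      copy u = F₂.nonforking-amalgam e b basic (u ⊙ u₀)

      -- The big model grows to an amalgam with a new copy of `N`, which universality returns to
      -- `M*`; the small model remains `M`.
      rule : Index → End → ∀ P → Step P
      rule _ u P = record
        { move   = move′
        ; target = mkSub (move′ ⊙ inclusion P)
        ; moves  = mkOver id↪ λ _ → refl
        }
        where move′ = universal (target (copy u)) ⊙ f (copy u)

      P₀ : Sub
      P₀ = mkSub u₀

      hom : Index → Index → End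
      hom = H P₀ rule

      chain : IsPairChain (ω cl) (P P₀ rule) hom
      chain = isPairChain P₀ rule

      module L = Limit (limit ω-small chain)

      closed : ClosedChain (ω cl)
      closed = record
        { chain      = IsPairChain.bigChain chain
        ; size-below = λ _ → Model.size M*
        ; continuous = λ j lim → contradiction lim (ω-no-limit-points cl j)
        ; top        = M*
        ; isUnion    = record
          { inj           = λ i → ⟦ L.inj i ⟧
          ; inj-embedding = λ i → strong-embedding (strong (L.inj i))
          ; inj-hom       = L.inj-hom
          ; cover         = L.cover
          }
        }

      u : Index → M ↪ M*
      u i = hom bottom i ⊙ u₀

      w : M ↪ M*
      w = L.inj bottom ⊙ u₀

      -- `ClosedChain.at` rebuilds the model with its own proof of membership, hence this identity
      -- map.
      at↪M* : ∀ i → ClosedChain.at closed i ↪ M*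
      at↪M* _ = mk↪ id (strong (id↪ {M = M*}))

      local : ∀ q → G₂.Basic M* q → ∃[ i ] F₂.Free (L.inj i) q
      local q bq = case G₂.localCharacter (ω cl) ω-small closed q bq of λ (i , d) →
        i , F₂.free-base (at↪M* i) (L.inj i) (F₂.free-≗ (λ _ → refl) (F₂.free d))

      next : ∀ i → Σ[ v ∈ target (copy (hom bottom i)) ↪ M* ] ⟦ v ⊙ f (copy (hom bottom i)) ⟧ ≗ ⟦ L.inj i ⟧
      next i = case successor P₀ rule i of λ (j , i<j , hom-eq , _) →
        L.inj j ⊙ universal (target (copy (hom bottom i))) ,
        λ x → trans (cong ⟦ L.inj j ⟧ (sym (hom-eq x))) (L.inj-hom (inj₁ i<j) x)

    copyChain : CopyChain e b
    copyChain = record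
      { Index    = Index
      ; Q        = λ _ → M*
      ; top      = M*
      ; base     = u
      ; inj      = L.inj
      ; w        = w
      ; base-top = λ i x → L.inj-hom (bottom-least i) (⟦ u₀ ⟧ x)
      ; copy     = λ i → copy (hom bottom i)
      ; into     = λ i → proj₁ (next i)
      ; into-f   = λ i → proj₂ (next i)
      ; local    = local
      }

-- Resolving an extension into uniqueness triples

module Resolution (cl : Classical) {ℓ} {K : AEC ℓ} {Λ : Set ℓ} (ls : AEC.LS K ↣ Λ)
                  (𝔰₁ 𝔰₂ : GoodFrame K Λ) (same : SameBasicTypes 𝔰₁ 𝔰₂) where
  open AEC K
  open Choice cl
  open Comparison cl ls 𝔰₁ 𝔰₂ same
  open Pairs cl K Λ M* superlimit
  open IsSuperlimit superlimit using (universal)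

  module _ (N₀ : Model K Λ) where

    -- The invariant of the construction; `b` places `N₀` in the current big model.
    record Transferred (b : N₀ ↪ M*) (P : Sub) : Set (Level.suc ℓ) where
      field
        map       : N₀ ↪ small P
        commute   : ⟦ inclusion P ⊙ map ⟧ ≗ ⟦ b ⟧
        transfers : Transfers map

    transferred-≗ : ∀ {b b′ P} → ⟦ b ⟧ ≗ ⟦ b′ ⟧ → Transferred b P → Transferred b′ P
    transferred-≗ eq o = record { map = map ; commute = λ x → trans (commute x) (eq x) ; transfers = transfers }
      where open Transferred o

    transferred-apex : ∀ {δ pair hom} (κ : δ < Λ ⁺) (C : IsPairChain δ pair hom) (c : Cocone C) →
              IsContinuous abstractClass (IsPairChain.smallChain C) →
              let open LimitOrdinal δ
                  open Cocone c
              in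
              (b : N₀ ↪ M*) → (∀ i → Transferred (hom bottom i ⊙ b) (pair i)) → Transferred (inj bottom ⊙ b) apex
    transferred-apex {δ} {pair} {hom} κ C c continuous b ok = record
      { map       = toTop bottom ⊙ n
      ; commute   = λ x → trans (commutes (over-apex bottom) _) (cong ⟦ inj bottom ⟧
                      (trans (Transferred.commute (ok bottom) x) (hom-id bottom (⟦ b ⟧ x))))
      ; transfers = transfers-union δ κ closed n λ i →
          transfers-≗ (λ x → ↪-injective (inclusion (pair i)) (trans (Transferred.commute (ok i) x)
              (sym (trans (commutes (over (bottom-least i)) _) (cong ⟦ hom bottom i ⟧
                (trans (Transferred.commute (ok bottom) x) (hom-id bottom (⟦ b ⟧ x))))))))
            (transfers-comp (Transferred.map (ok i)) (to-at i) (Transferred.transfers (ok i))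
              (transfers-iso (to-at i) (from-at i) (λ _ → refl)))
      }
      where
      open LimitOrdinal δ
      open IsPairChain C
      open Cocone c

      closed : ClosedChain δ
      closed = closedChain continuous

      open ClosedChain closed using (at; step; toTop)

      to-at : ∀ i → small (pair i) ↪ at i
      to-at i = mk↪ id (strong (id↪ {M = small (pair i)}))

      from-at : ∀ i → at i ↪ small (pair i)
      from-at i = mk↪ id (strong (id↪ {M = small (pair i)}))

      n : N₀ ↪ at bottom
      n = mk↪ ⟦ Transferred.map (ok bottom) ⟧ (strong (Transferred.map (ok bottom)))

    Contains : Sub → ∣ M* ∣ → Set ℓ
    Contains P y = ∃[ x ] ⟦ inclusion P ⟧ x ≡ y

    -- At stage k perform some admissible step meeting the demand D k, if there is one.
    module Greedy (δ : LimitOrdinal ℓ) (irrelevant : Irrelevant (LimitOrdinal._<_ δ)) (κ : δ < Λ ⁺)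
                  (b : N₀ ↪ M*) (P₀ : Sub) (ok₀ : Transferred b P₀)
                  (D : LimitOrdinal.Index δ → End → ∀ {P} → Step P → Set (Level.suc ℓ)) where
      open Order δ
      open Recursion cl K Λ M* superlimit δ irrelevant κ

      Admissible : Index → End → Sub → Set (Level.suc ℓ)
      Admissible k h P = Σ[ S ∈ Step P ] Transferred (move S ⊙ h ⊙ b) (target S) × D k h S

      private
        stay : ∀ P → Step P
        stay P = record { move = id↪ ; target = P ; moves = over-id λ _ → refl }

      abstract
        rule : Index → End → ∀ P → Step P
        rule k h P with em (Admissible k h P)
        ... | yes (S , _) = S
        ... | no _        = stay P

        rule-transferred : ∀ k h P → Transferred (h ⊙ b) P → Transferred (move (rule k h P) ⊙ h ⊙ b) (target (rule k h P))
        rule-transferred k h P ok with em (Admissible k h P)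
        ... | yes (_ , ok′ , _) = ok′
        ... | no _              = transferred-≗ (λ _ → refl) ok

        rule-demand : ∀ k h P → Admissible k h P → D k h (rule k h P)
        rule-demand k h P adm with em (Admissible k h P)
        ... | yes (_ , _ , d) = d
        ... | no ¬adm         = contradiction adm ¬adm

      pairs : Index → Sub
      pairs = P P₀ rule

      hom : Index → Index → End
      hom = H P₀ rule

      chain : IsPairChain δ pairs hom
      chain = isPairChain P₀ rule

      open IsPairChain chain using (hom-id; hom-comp)

      private
        transferred-subst : ∀ {b P Q} → Q ≡ P → Transferred b P → Transferred b Q
        transferred-subst refl o = o

      transferred-at : ∀ j → Transferred (hom bottom j ⊙ b) (pairs j)
      transferred-at = WF.All.wfRec wellFounded _ (λ j → Transferred (hom bottom j ⊙ b) (pairs j)) λ j ih →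
        go j (λ i p → ih {i} p) (view P₀ rule j)
        where
        go : ∀ j → (∀ i → i < j → Transferred (hom bottom i ⊙ b) (pairs i)) → View P₀ rule j (state P₀ rule j) →
             Transferred (hom bottom j ⊙ b) (pairs j)
        go j ih (isZero none eq) with bottom-least j
        ... | inj₁ p    = contradiction p (none bottom)
        ... | inj₂ refl = transferred-subst eq (transferred-≗ (λ x → sym (hom-id j (⟦ b ⟧ x))) ok₀)
        go j ih (isSucc k k<j _ eq eq′) = transferred-subst eq′
          (transferred-≗ (λ x → trans (sym (eq _)) (hom-comp (bottom-least k) (inj₁ k<j) (⟦ b ⟧ x)))
            (rule-transferred k (hom bottom k) (pairs k) (ih k k<j)))
        go j ih (isLimit lim _) =
          transferred-apex (segment-small j lim κ) _ (cocone-at P₀ rule j lim) (segment-continuous P₀ rule j lim) b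
            λ (i , p) → ih i p
          where open Segment δ irrelevant

      abstract
        union : Limit chain
        union = limit κ chain

      open Limit union

      transferred-union : Transferred (inj bottom ⊙ b) apex
      transferred-union = transferred-apex κ chain cocone (continuous P₀ rule) b transferred-at

      over-union : Over (inj bottom) P₀ apex
      over-union = subst (λ P → Over (inj bottom) P apex) (P-bottom P₀ rule) (over-apex bottom)

      -- Factoring `inj k` through the step taken at stage `k` makes what that step achieved visible
      -- in the union.
      record DemandMet (k : Index) : Set (Level.suc ℓ) where
        field
          step    : Step (pairs k)
          demand  : D k (hom bottom k) step
          rest    : End
          rest-eq : ⟦ rest ⊙ move step ⟧ ≗ ⟦ inj k ⟧
          over    : Over rest (target step) apex

      demand-met : ∀ k → Admissible k (hom bottom k) (pairs k) → DemandMet k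
      demand-met k adm = go (successor P₀ rule k)
        where
        go : (∃[ j ] Σ[ p ∈ k < j ] ⟦ hom k j ⟧ ≗ ⟦ move (rule k (hom bottom k) (pairs k)) ⟧
                × pairs j ≡ target (rule k (hom bottom k) (pairs k))) → DemandMet k
        go (j , k<j , eq , eq′) = record
          { step    = rule k (hom bottom k) (pairs k)
          ; demand  = rule-demand k (hom bottom k) (pairs k) adm
          ; rest    = inj j
          ; rest-eq = λ x → trans (cong ⟦ inj j ⟧ (sym (eq x))) (inj-hom (inj₁ k<j) x)
          ; over    = subst (λ P → Over (inj j) P apex) eq′ (over-apex j)
          }

    contains-over : ∀ {s P Q y} → Over s P Q → Contains P y → Contains Q (⟦ s ⟧ y)
    contains-over {s = s} o (x , eq) = ⟦ lower o ⟧ x , trans (commutes o x) (cong ⟦ s ⟧ eq)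

    -- Only points `a` of the big model before `S` are considered; points that `S` adds to it must
    -- wait for another round.
    Saturates : N₀ ↪ M* → ∀ {P} → Step P → Set (Level.suc ℓ)
    Saturates b S = ∀ a (S′ : Step (target S)) → Transferred (move S′ ⊙ move S ⊙ b) (target S′) →
      Contains (target S′) (⟦ move S′ ⊙ move S ⟧ a) → Contains (target S) (⟦ move S ⟧ a)

    module _ (b : N₀ ↪ M*) (P₀ : Sub) (ok₀ : Transferred b P₀) where
      private
        W : WellOrder Λ
        W = Zermelo.wellOrder cl Λ

        element : Λ → ∣ M* ∣
        element = Inverse.from (Model.size M*)

        code : ∣ M* ∣ → Λ
        code = Inverse.to (Model.size M*)

        D : Λ ⊎ ℕ → End → ∀ {P} → Step P → Set (Level.suc ℓ)
        D (inj₁ l) h S = Lift (Level.suc ℓ) (Contains (target S) (⟦ move S ⊙ h ⟧ (element l)))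
        -- On the copy of ω no step is admissible, so the pair stays as it is.
        D (inj₂ _) h S = ⊥ℓ

        module G = Greedy (withω cl W) (withω-irrelevant cl W) (absorb-ω cl ℕ↣Λ) b P₀ ok₀ D
        open LimitOrdinal (withω cl W) using (bottom; bottom-least)
        open Limit G.union

      -- If a further step `S′` absorbs `a`, then the rest of the construction followed by `S′` was
      -- an admissible step at stage `code a`. So the step chosen at that stage absorbed `a`.
      saturate : Σ[ S ∈ Step P₀ ] Transferred (move S ⊙ b) (target S) × Saturates b S
      saturate = record { move = inj bottom ; target = apex ; moves = G.over-union } , G.transferred-union , saturates
        where
        saturates : Saturates b (record { move = inj bottom ; target = apex ; moves = G.over-union })
        saturates a S′ ok (y , eq) = subst (Contains apex)
          (trans (rest-eq _) (back a)) (contains-over over (Level.lower demand))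
          where
          k = inj₁ (code a)

          back : ∀ x → ⟦ inj k ⊙ G.hom bottom k ⟧ (element (code x)) ≡ ⟦ inj bottom ⟧ x
          back x = trans (inj-hom (bottom-least k) _) (cong ⟦ inj bottom ⟧ (Inverse.strictlyInverseʳ (Model.size M*) x))

          S″ : Step (G.pairs k)
          S″ = record { move = move S′ ⊙ inj k ; target = target S′ ; moves = over-comp (moves S′) (over-apex k) }

          open G.DemandMet (G.demand-met k (S″ ,
            transferred-≗ (λ x → cong ⟦ move S′ ⟧ (sym (inj-hom (bottom-least k) (⟦ b ⟧ x)))) ok ,
            lift (y , trans eq (cong ⟦ move S′ ⟧ (sym (back a))))))

    module _ (ws : WeaklySuccessful 𝔰₂) where

      -- Weak successfulness realizes the type of `y` by a uniqueness triple. Equality of types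
      -- embeds the triple and the big model in a model `T` with the realization equal to `y`, and
      -- universality returns `T` to `M*`.
      add-basic : ∀ {b P} → Transferred b P → ∀ y → G₂.Basic (small P) (gtp (inclusion P) y) →
                  Σ[ S ∈ Step P ] Transferred (move S ⊙ b) (target S) × Contains (target S) (⟦ move S ⟧ y)
      add-basic {b} {P} ok y basic = go (ws (small P) (gtp (inclusion P) y) basic)
        where
        open Transferred ok
        go : Σ[ N ∈ Model K Λ ] Σ[ e ∈ (small P ↪ N) ] ∃[ a ] gtp (inclusion P) y ∼ gtp e a × IsUniquenessTriple 𝔰₂ e a →
             Σ[ S ∈ Step P ] Transferred (move S ⊙ b) (target S) × Contains (target S) (⟦ move S ⟧ y)
        go (N , e , a , (T , t₁ , t₂ , eq , eq′) , triple) =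
          record { move = j ⊙ t₁ ; target = mkSub (j ⊙ t₂) ; moves = mkOver e λ x → cong ⟦ j ⟧ (sym (eq x)) } ,
          record
            { map       = e ⊙ map
            ; commute   = λ x → cong ⟦ j ⟧ (trans (sym (eq (⟦ map ⟧ x))) (cong ⟦ t₁ ⟧ (commute x)))
            ; transfers = transfers-comp map e transfers (triple-transfers triple (copyChain e a (proj₁ triple)))
            } ,
          a , cong ⟦ j ⟧ (sym eq′)
          where j = universal T

      module _ (b : N₀ ↪ M*) (P₀ : Sub) (ok₀ : Transferred b P₀) where
        private
          D : LimitOrdinal.Index (ω cl {ℓ}) → End → ∀ {P} → Step P → Set (Level.suc ℓ)
          D _ h S = Saturates (h ⊙ b) S

          module G = Greedy (ω cl) (withω-irrelevant cl ⊥-wellOrder) ω-small b P₀ ok₀ D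
          open LimitOrdinal (ω cl {ℓ}) using (bottom; bottom-least)
          open Limit G.union

          -- A missing basic point `y` comes from the big model of some round `k`. The maps after
          -- that round followed by the step of `add-basic` would absorb it, so by saturation round
          -- `k` already did.
          onto : IsOnto ⟦ inclusion apex ⟧
          onto = by-contradiction λ ¬onto →
            case G₂.density (inclusion apex) ¬onto of λ (y , y∉ , basic) →
            case cover y of λ (k , x , eq) →
            case add-basic G.transferred-union y basic of λ (S , ok , y∈) →
            y∉ (absorbed y k x eq S ok y∈)
            where
            absorbed : ∀ y k x → ⟦ inj k ⟧ x ≡ y → (S : Step apex) → Transferred (move S ⊙ inj bottom ⊙ b) (target S) →
                       Contains (target S) (⟦ move S ⟧ y) → Contains apex y
            absorbed y k x eq S ok (z , z-eq) = subst (Contains apex) (trans (rest-eq x) eq)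
              (contains-over over (demand x S″
                (transferred-≗ (λ n → cong ⟦ move S ⟧ (sym (trans (rest-eq _) (inj-hom (bottom-least k) (⟦ b ⟧ n))))) ok)
                (z , trans z-eq (cong ⟦ move S ⟧ (sym (trans (rest-eq x) eq))))))
              where
              open G.DemandMet (G.demand-met k (saturate (G.hom bottom k ⊙ b) (G.pairs k) (G.transferred-at k)))
              S″ : Step (target step)
              S″ = record { move = move S ⊙ rest ; target = target S ; moves = over-comp (moves S) over }

        resolve : Σ[ u ∈ End ] Σ[ P ∈ Sub ] Transferred (u ⊙ b) P × IsOnto ⟦ inclusion P ⟧
        resolve = inj bottom , apex , G.transferred-union , onto

  -- Coherence applies once `g` is an embedding, and this is reflected from `k` along the embedding
  -- `h`.
  factor-strong : ∀ {M N P : Model K Λ} (h : N ↪ P) (k : M ↪ P) {g} → ⟦ h ⟧ ∘ g ≗ ⟦ k ⟧ →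
                  Strong (Model.structure M) (Model.structure N) g
  factor-strong {M} {N} {P} h k {g} eq =
    coherence embedding (strong h) (subst (Strong _ _) (sym h∘g≡k) (strong k))
    where
    module M = Structure (Model.structure M)
    module N = Structure (Model.structure N)
    module P = Structure (Model.structure P)
    module h = IsEmbedding (strong-embedding (strong h))
    module k = IsEmbedding (strong-embedding (strong k))

    h∘g≡k : ⟦ h ⟧ ∘ g ≡ ⟦ k ⟧
    h∘g≡k = ext eq

    map-k : ∀ {n} (xs : Vec ∣ M ∣ n) → Vec.map ⟦ k ⟧ xs ≡ Vec.map ⟦ h ⟧ (Vec.map g xs)
    map-k xs = trans (Vec.map-cong (λ x → sym (eq x)) xs) (Vec.map-∘ ⟦ h ⟧ g xs)

    embedding : IsEmbedding (Model.structure M) (Model.structure N) g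
    embedding = record
      { injective = λ {x} {y} p → k.injective (trans (sym (eq x)) (trans (cong ⟦ h ⟧ p) (eq y)))
      ; fun-homo  = λ F xs → h.injective (trans (eq _) (trans (k.fun-homo F xs)
          (trans (cong (P.fun F) (map-k xs)) (sym (h.fun-homo F (Vec.map g xs))))))
      ; rel-iff   = λ R xs → mk⇔
          (λ r → Equivalence.from (h.rel-iff R _) (subst (P.rel R) (map-k xs) (Equivalence.to (k.rel-iff R xs) r)))
          (λ r → Equivalence.from (k.rel-iff R xs) (subst (P.rel R) (sym (map-k xs)) (Equivalence.to (h.rel-iff R _) r)))
      }

  -- The resolution starts with `M` placed in `M*` through `N`. At its end the transferring map out
  -- of `M` factors through `f`, and `transfers-cancel` applies.
  transfers-all : WeaklySuccessful 𝔰₂ → ∀ {M N : Model K Λ} (f : M ↪ N) → Transfers f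
  transfers-all ws {M} {N} f = go (resolve M ws (j ⊙ f) (mkSub (j ⊙ f)) record
      { map = id↪ ; commute = λ _ → refl ; transfers = transfers-iso id↪ id↪ λ _ → refl })
    where
    j = universal N

    go : Σ[ u ∈ End ] Σ[ P ∈ Sub ] Transferred M (u ⊙ j ⊙ f) P × IsOnto ⟦ inclusion P ⟧ → Transfers f
    go (u , P , ok , onto) = transfers-cancel f g
      (transfers-≗ (λ x → ↪-injective (inclusion P) (trans (Transferred.commute ok x) (sym (proj₂ (onto _))))) (Transferred.transfers ok))
      where
      g : N ↪ small P
      -- The final inclusion is onto, so the map of `N` into the big model lifts to the small one.
      g = mk↪ (λ x → proj₁ (onto (⟦ u ⊙ j ⟧ x)))
        (factor-strong (inclusion P) (u ⊙ j) λ x → proj₂ (onto (⟦ u ⊙ j ⟧ x)))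

theorem6p13 : Classical →
    ∀ {ℓ} (K : AEC ℓ) (Λ : Set ℓ) → (AEC.LS K ↣ Λ) →
    (𝔰₁ 𝔰₂ : GoodFrame K Λ) →
    WeaklySuccessful 𝔰₁ → WeaklySuccessful 𝔰₂ →
    SameBasicTypes 𝔰₁ 𝔰₂ → SameNonforking 𝔰₁ 𝔰₂
theorem6p13 cl K Λ ls 𝔰₁ 𝔰₂ ws₁ ws₂ same f g a = mk⇔
  (λ nf → F₂.free⇒nf (Resolution.transfers-all cl ls 𝔰₁ 𝔰₂ same ws₂ f (gtp g a) (F₁.nf⇒free nf)))
  (λ nf → F₁.free⇒nf (Resolution.transfers-all cl ls 𝔰₂ 𝔰₁ same′ ws₁ f (gtp g a) (F₂.nf⇒free nf)))
  where
  module F₁ = FrameLemmas 𝔰₁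
  module F₂ = FrameLemmas 𝔰₂

  same′ : SameBasicTypes 𝔰₂ 𝔰₁
  same′ M p = mk⇔ (Equivalence.from (same M p)) (Equivalence.to (same M p))
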